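{- Let $\mathcal{F}$ be a forbidden family and let $k,d\in\mathbb{N}$. Let $G_1,G_2,\dots,G_d$ be graphs, each with $\mathcal{F}$-free chromatic number $\chi(G_i,\mathcal{F})\leq k+1$. Then $$\chi(G_1\,\square\,G_2\,\square\cdots\square\,G_d,\mathcal{F})\leq 2k(kd-k+1)+1.$$ Moreover, for all $\epsilon>0$ and for large $d>d(k,\epsilon)$, $$\chi(G_1\,\square\,G_2\,\square\cdots\square\,G_d,\mathcal{F})\leq 1+\frac{2e^{\gamma}}{1-\epsilon}\,dk\log k.$$
   Context: All graphs are finite, simple and undirected. $\mathbb{N}=\{1,2,\dots\}$, $\gamma=0.5772\ldots$ is Euler's constant, and $\log$ is the natural logarithm. A colouring of a graph $G$ is a function $c:V(G)\to\mathbb{Z}$ with $c(v)\neq c(w)$ for every edge $vw\in E(G)$; it is a $k$-colouring if it takes at most $k$ distinct values. A forbidden family $\mathcal{F}$ is a family of connected bipartite graphs, each with at least three vertices. A colouring $c$ of $G$ is $\mathcal{F}$-free if $|\{c(v):v\in V(H)\}|\geq 3$ for every subgraph $H$ of $G$ that is isomorphic to a graph in $\mathcal{F}$. The $\mathcal{F}$-free chromatic number $\chi(G,\mathcal{F})$ is the minimum integer $k$ such that $G$ has an $\mathcal{F}$-free $k$-colouring. The cartesian product $G_1\,\square\,G_2\,\square\cdots\square\,G_d$ has vertex set $V(G_1)\times\cdots\times V(G_d)$, where $(v_1,\dots,v_d)$ and $(w_1,\dots,w_d)$ are adjacent if and only if $v_iw_i\in E(G_i)$ for some $i$ and $v_j=w_j$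 for all $j\neq i$. Here $d(k,\epsilon)$ denotes a threshold depending on $k$ and $\epsilon$.
   Formalization: The "moreover" bound is stated for k ≥ 2 and 0 < ε < 1: at k = 1 it reads 1 and fails for products of copies of K_2, at ε = 1 it is undefined, and for ε > 1 its right-hand side is less than 1, so it fails. -}

module Defs where

open import Data.Bool.Base using (Bool)
open import Data.Empty using (⊥-elim)
open import Data.Fin.Base using (Fin; zero; suc; inject≤; toℕ)
import Data.Fin.Properties as Fin
open import Data.Integer.Base as ℤ using (ℤ; +_; -[1+_])
import Data.Integer.Properties as ℤ
open import Data.Nat.Base as ℕ using (ℕ; zero; suc)
import Data.Nat.Properties as ℕ
open import Data.Nat.Tactic.RingSolver using (solve-∀)
open import Data.Product.Base using (Σ; ∃; _×_; _,_; proj₁; proj₂)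
open import Data.Product.Function.NonDependent.Propositional using (_×-↔_)
open import Data.Rational.Base as ℚ
  using (ℚ; 0ℚ; 1ℚ; ½; mkℚ; _/_; ∣_∣; Positive; NonNegative; positive; nonNegative)
import Data.Rational.Base as ℚ-base
import Data.Rational.Properties as ℚ
open import Data.Rational.Solver using (module +-*-Solver)
import Data.Rational.Unnormalised.Base as ℚᵘ
import Data.Rational.Unnormalised.Properties as ℚᵘ
open import Data.Unit.Base using (⊤)
open import Data.Vec.Base using (Vec; []; _∷_; lookup)
open import Function.Base using (_∘_)
open import Function.Bundles using (_↔_; _⇔_; Inverse)
open import Function.Definitions using (Injective)
open import Function.Properties.Inverse using (↔-sym; ↔-trans; ↔⇒↣)
open import Level using (0ℓ)
open import Relation.Binary.Construct.Closure.ReflexiveTransitive using (Star)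
open import Relation.Binary.Core using (Rel)
open import Relation.Binary.Definitions
  using (Decidable; DecidableEquality; Irreflexive; Symmetric)
open import Relation.Binary.PropositionalEquality
open import Relation.Nullary.Decidable using (yes; no; _×-dec_; _→-dec_; ¬?)
open import Relation.Nullary.Negation using (¬_)
open import Relation.Unary using (Pred; U)

record Graph : Set₁ where
  field
    V      : Set
    order  : ℕ
    V↔Fin  : V ↔ Fin order
    Adj    : Rel V 0ℓ
    Adj?   : Decidable Adj
    symm   : Symmetric Adj
    irrefl : Irreflexive _≡_ Adj

  infix 4 _≟_
  _≟_ : DecidableEquality V
  _≟_ = Fin.inj⇒≟ (↔⇒↣ V↔Fin)

open Graph using (V; order; Adj)

Connected : Graph → Set
Connected G = ∀ (v w : V G) → Star (Adj G) v w

Bipartite : Graph → Set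
Bipartite G = Σ (V G → Bool) λ side → ∀ {v w} → Adj G v w → side v ≢ side w

record Subgraph (G : Graph) : Set₁ where
  field
    Vᴴ        : Pred (V G) 0ℓ
    Adjᴴ      : Rel (V G) 0ℓ
    symᴴ      : Symmetric Adjᴴ
    endpoints : ∀ {v w} → Adjᴴ v w → Vᴴ v × Vᴴ w
    Adjᴴ⇒Adj  : ∀ {v w} → Adjᴴ v w → Adj G v w

-- A is isomorphic to the subgraph H of G: a bijection from V A onto the
-- vertex set of H that preserves and reflects adjacency.
record _≅_ (A : Graph) {G : Graph} (H : Subgraph G) : Set where
  open Subgraph H
  field
    to         : V A → V G
    injective  : Injective _≡_ _≡_ to
    to∈        : ∀ a → Vᴴ (to a)
    surjective : ∀ {v} → Vᴴ v → ∃ λ a → to a ≡ v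
    adjacency  : ∀ {a b} → Adj A a b ⇔ Adjᴴ (to a) (to b)

infix 4 _≅_

Tuple : ∀ {d} → Vec Graph d → Set
Tuple []       = ⊤
Tuple (G ∷ Gs) = V G × Tuple Gs

infixl 8 _at_
_at_ : ∀ {d} {Gs : Vec Graph d} → Tuple Gs → (i : Fin d) → V (lookup Gs i)
_at_ {Gs = _ ∷ _} (v , _)  zero    = v
_at_ {Gs = _ ∷ _} (_ , vs) (suc i) = vs at i

Tuple↔Fin : ∀ {d} (Gs : Vec Graph d) → ∃ λ n → Tuple Gs ↔ Fin n
Tuple↔Fin []       = 1 , ↔-sym Fin.1↔⊤
Tuple↔Fin (G ∷ Gs) =
  _ , ↔-trans (Graph.V↔Fin G ×-↔ proj₂ (Tuple↔Fin Gs)) (↔-sym Fin.*↔×)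

□ : ∀ {d} → Vec Graph d → Graph
□ {d} Gs = record
  { V      = Tuple Gs
  ; order  = proj₁ (Tuple↔Fin Gs)
  ; V↔Fin  = proj₂ (Tuple↔Fin Gs)
  ; Adj    = λ v w → ∃ λ (i : Fin d) →
               Adj (lookup Gs i) (v at i) (w at i) × (∀ j → j ≢ i → v at j ≡ w at j)
  ; Adj?   = λ v w → Fin.any? λ i →
               Graph.Adj? (lookup Gs i) (v at i) (w at i)
               ×-dec Fin.all? λ j →
                 ¬? (j Fin.≟ i) →-dec Graph._≟_ (lookup Gs j) (v at j) (w at j)
  ; symm   = λ { (i , a , eq) → i , Graph.symm (lookup Gs i) a , λ j j≢i → sym (eq j j≢i) }
  ; irrefl = λ { refl (i , a , _) → Graph.irrefl (lookup Gs i) refl a }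
  }

AtLeast AtMost : ∀ {A : Set} → ℕ → Pred A 0ℓ → Set
AtLeast {A} n X = Σ (Fin n → A) λ f → Injective _≡_ _≡_ f × (∀ i → X (f i))
AtMost  {A} n X = Σ (Fin n → A) λ f → ∀ {x} → X x → ∃ λ i → f i ≡ x

-- {c(v) : v ∈ S}
Colours : ∀ {W : Set} → (W → ℤ) → Pred W 0ℓ → Pred ℤ 0ℓ
Colours c S z = ∃ λ v → S v × c v ≡ z

IsColouring : (G : Graph) → (V G → ℤ) → Set
IsColouring G c = ∀ {v w} → Adj G v w → c v ≢ c w

IsForbiddenFamily : ∀ {ℓ} → Pred Graph ℓ → Set _
IsForbiddenFamily 𝓕 = ∀ {A} → 𝓕 A → Connected A × Bipartite A × 3 ℕ.≤ order A

IsFree : ∀ {ℓ} → Pred Graph ℓ → (G : Graph) → (V G → ℤ) → Set _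
IsFree 𝓕 G c = ∀ (H : Subgraph G) (A : Graph) → 𝓕 A → A ≅ H →
               AtLeast 3 (Colours c (Subgraph.Vᴴ H))

HasFreeColouring : ∀ {ℓ} → Pred Graph ℓ → Graph → ℕ → Set _
HasFreeColouring 𝓕 G k = Σ (V G → ℤ) λ c →
  IsColouring G c × AtMost k (Colours c U) × IsFree 𝓕 G c

-- χ(G, 𝓕) = k.  For an arbitrary family 𝓕 the minimum is not computable,
-- so χ(G, 𝓕) is specified by a (single-valued) relation.
IsFreeChromaticNumber : ∀ {ℓ} → Pred Graph ℓ → Graph → ℕ → Set _
IsFreeChromaticNumber 𝓕 G k =
  HasFreeColouring 𝓕 G k × (∀ j → HasFreeColouring 𝓕 G j → k ℕ.≤ j)

-- The relation is classically total: colouring all vertices differently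
-- is 𝓕-free, so some least number of colours exists.
module _ {ℓ} {𝓕 : Pred Graph ℓ} (forb : IsForbiddenFamily 𝓕) (G : Graph) where
  private
    number : V G → ℤ
    number = +_ ∘ toℕ ∘ Inverse.to (Graph.V↔Fin G)

    to-injective : ∀ (A : Graph) → Injective _≡_ _≡_ (Inverse.to (Graph.V↔Fin A))
    to-injective A {x} {y} eq =
      trans (sym (strictlyInverseʳ x)) (trans (cong from eq) (strictlyInverseʳ y))
      where open Inverse (Graph.V↔Fin A)

    from-injective : ∀ (A : Graph) → Injective _≡_ _≡_ (Inverse.from (Graph.V↔Fin A))
    from-injective A {x} {y} eq =
      trans (sym (strictlyInverseˡ x)) (trans (cong to eq) (strictlyInverseˡ y))
      where open Inverse (Graph.V↔Fin A)

    number-injective : Injective _≡_ _≡_ number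
    number-injective = to-injective G ∘ Fin.toℕ-injective ∘ ℤ.+-injective

    number-isFree : IsFree 𝓕 G number
    number-isFree H A A∈𝓕 iso = number ∘ place
        , (λ eq → Fin.inject≤-injective 3≤ 3≤ _ _
                    (from-injective A (_≅_.injective iso (number-injective eq))))
        , (λ i → place i , _≅_.to∈ iso _ , refl)
      where
      3≤ : 3 ℕ.≤ order A
      3≤ = proj₂ (proj₂ (forb A∈𝓕))
      place : Fin 3 → V G
      place i = _≅_.to iso (Inverse.from (Graph.V↔Fin A) (inject≤ i 3≤))

  hasFreeColouring : HasFreeColouring 𝓕 G (order G)
  hasFreeColouring = number
    , (λ a eq → Graph.irrefl G (number-injective eq) a)
    , (+_ ∘ toℕ , λ { (v , _ , eq) → Inverse.to (Graph.V↔Fin G) v , eq })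
    , number-isFree

  private
    least : ∀ n → ¬ (∃ (IsFreeChromaticNumber 𝓕 G)) →
            ∀ m → m ℕ.< n → ¬ HasFreeColouring 𝓕 G m
    least (suc n) none m m<1+n col = none (m , col , minimal)
      where
      minimal : ∀ j → HasFreeColouring 𝓕 G j → m ℕ.≤ j
      minimal j colⱼ with m ℕ.≤? j
      ... | yes m≤j = m≤j
      ... | no  m≰j =
        ⊥-elim (least n none j (ℕ.<-≤-trans (ℕ.≰⇒> m≰j) (ℕ.≤-pred m<1+n)) colⱼ)

  ¬¬-freeChromaticNumber : ¬ ¬ ∃ (IsFreeChromaticNumber 𝓕 G)
  ¬¬-freeChromaticNumber none =
    least (suc (order G)) none (order G) ℕ.≤-refl hasFreeColouring

module ℚ-Lemmas where
  open ℚ-base using (_+_; _*_; _-_; -_; _≤_; _<_; _⊔_; 1/_)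
  open ℚ.≤-Reasoning
  open +-*-Solver

  /-mono : ∀ i j m n → i ℕ.* suc n ℕ.≤ j ℕ.* suc m → + i / suc m ≤ + j / suc n
  /-mono i j m n le = ℚ.toℚᵘ-cancel-≤ (ℚᵘ.≤-respˡ-≃ (ℚᵘ.≃-sym (ℚ.toℚᵘ-fromℚᵘ (ℚᵘ.mkℚᵘ (+ i) m)))
    (ℚᵘ.≤-respʳ-≃ (ℚᵘ.≃-sym (ℚ.toℚᵘ-fromℚᵘ (ℚᵘ.mkℚᵘ (+ j) n)))
      (ℚᵘ.*≤* (subst₂ ℤ._≤_ (ℤ.pos-* i (suc n)) (ℤ.pos-* j (suc m)) (ℤ.+≤+ le)))))

  /-suc : ∀ i m → + i / suc m + + 1 / suc m ≡ + suc i / suc m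
  /-suc i m = ℚ.toℚᵘ-injective (ℚᵘ.≃-trans (ℚ.toℚᵘ-homo-+ (+ i / suc m) (+ 1 / suc m))
    (ℚᵘ.≃-trans (ℚᵘ.+-cong (ℚ.toℚᵘ-fromℚᵘ (ℚᵘ.mkℚᵘ (+ i) m)) (ℚ.toℚᵘ-fromℚᵘ (ℚᵘ.mkℚᵘ (+ 1) m)))
    (ℚᵘ.≃-trans (ℚᵘ.*≡* eq) (ℚᵘ.≃-sym (ℚ.toℚᵘ-fromℚᵘ (ℚᵘ.mkℚᵘ (+ suc i) m))))))
    where
    arith : ∀ i m → (i ℕ.* suc m ℕ.+ 1 ℕ.* suc m) ℕ.* suc m ≡ suc i ℕ.* (suc m ℕ.* suc m)
    arith = solve-∀
    eq : (+ i ℤ.* + suc m ℤ.+ + 1 ℤ.* + suc m) ℤ.* + suc m ≡ + suc i ℤ.* (+ suc m ℤ.* + suc m)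
    eq = trans (cong (λ z → (z ℤ.+ + 1 ℤ.* + suc m) ℤ.* + suc m) (sym (ℤ.pos-* i (suc m))))
           (trans (sym (ℤ.pos-* (i ℕ.* suc m ℕ.+ 1 ℕ.* suc m) (suc m))) (cong +_ (arith i m)))

  /-* : ∀ i m → (+ i / 1) * (+ 1 / suc m) ≡ + i / suc m
  /-* i m = ℚ.toℚᵘ-injective (ℚᵘ.≃-trans (ℚ.toℚᵘ-homo-* (+ i / 1) (+ 1 / suc m))
    (ℚᵘ.≃-trans (ℚᵘ.*-cong (ℚ.toℚᵘ-fromℚᵘ (ℚᵘ.mkℚᵘ (+ i) 0)) (ℚ.toℚᵘ-fromℚᵘ (ℚᵘ.mkℚᵘ (+ 1) m)))
    (ℚᵘ.≃-trans (ℚᵘ.*≡* eq) (ℚᵘ.≃-sym (ℚ.toℚᵘ-fromℚᵘ (ℚᵘ.mkℚᵘ (+ i) m))))))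
    where
    eq : (+ i ℤ.* + 1) ℤ.* + suc m ≡ + i ℤ.* + (1 ℕ.* suc m)
    eq = cong₂ ℤ._*_ (ℤ.*-identityʳ (+ i)) (cong +_ (sym (ℕ.*-identityˡ (suc m))))

  /-pos : ∀ {m} → Positive (+ 1 / suc m)
  /-pos {m} = ℚ.normalize-pos 1 (suc m)

  /-nonNeg : ∀ {i m} → NonNegative (+ i / suc m)
  /-nonNeg {i} {m} = ℚ.normalize-nonNeg i (suc m)

  half-pos : ∀ ε .{{_ : Positive ε}} → Positive (½ * ε)
  half-pos ε = ℚ.pos*pos⇒pos ½ {{_}} ε

  halves : ∀ ε → ½ * ε + ½ * ε ≡ ε
  halves = solve 1 (λ ε → con ½ :* ε :+ con ½ :* ε := ε) refl

  ceiling : ∀ q → ∃ λ n → q ≤ + n / 1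
  ceiling q@(mkℚ (+ n) d c) = n , subst (_≤ + n / 1) (ℚ.↥p/↧p≡p q)
    (/-mono n n d 0 (ℕ.*-monoʳ-≤ n (ℕ.s≤s ℕ.z≤n)))
  ceiling q@(mkℚ -[1+ n ] d c) = 0 , ℚ.<⇒≤ (ℚ.negative⁻¹ q)

  archimedean : ∀ K ε .{{_ : Positive ε}} → ∃ λ N → ∀ n → N ℕ.≤ n → K * (+ 1 / suc n) ≤ ε
  archimedean K ε@(mkℚ (+ suc e) d c) with ceiling K
  ... | A , K≤A = A ℕ.* suc d , λ n N≤n → begin
    K * (+ 1 / suc n)          ≤⟨ ℚ.*-monoʳ-≤-nonNeg (+ 1 / suc n) {{/-nonNeg {1} {n}}} K≤A ⟩
    (+ A / 1) * (+ 1 / suc n)  ≡⟨ /-* A n ⟩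
    + A / suc n                ≤⟨ /-mono A (suc e) n d
                                    (ℕ.≤-trans N≤n (ℕ.≤-trans (ℕ.n≤1+n n) (ℕ.m≤m+n (suc n) _))) ⟩
    + suc e / suc d            ≡⟨ ℚ.↥p/↧p≡p ε ⟩
    ε                          ∎

  -∣-∣ : ∀ p q → ∣ p - q ∣ ≡ ∣ q - p ∣
  -∣-∣ p q = trans (sym (ℚ.∣-p∣≡∣p∣ (p - q)))
    (cong ∣_∣ (solve 2 (λ p q → :- (p :- q) := q :- p) refl p q))

  triangle : ∀ p q r → ∣ p - r ∣ ≤ ∣ p - q ∣ + ∣ q - r ∣
  triangle p q r = begin
    ∣ p - r ∣              ≡⟨ cong ∣_∣ (solve 3 (λ p q r → p :- r := (p :- q) :+ (q :- r)) refl p q r) ⟩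
    ∣ (p - q) + (q - r) ∣  ≤⟨ ℚ.∣p+q∣≤∣p∣+∣q∣ (p - q) (q - r) ⟩
    ∣ p - q ∣ + ∣ q - r ∣  ∎

  *-mono : ∀ {p q r s} → 0ℚ ≤ q → 0ℚ ≤ r → p ≤ q → r ≤ s → p * r ≤ q * s
  *-mono {p} {q} {r} {s} 0≤q 0≤r p≤q r≤s = ℚ.≤-trans
    (ℚ.*-monoʳ-≤-nonNeg r {{nonNegative 0≤r}} p≤q)
    (ℚ.*-monoˡ-≤-nonNeg q {{nonNegative 0≤q}} r≤s)

  -- If successive differences of f are dominated by those of c ≥ 0 from n₀ on,
  -- then f varies by at most 2 c(N) beyond any N ≥ n₀.
  module Telescope (f c : ℕ → ℚ) (n₀ : ℕ) (c≥0 : ∀ n → 0ℚ ≤ c n)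
    (step : ∀ n → n₀ ℕ.≤ n → ∣ f (suc n) - f n ∣ ≤ c n - c (suc n)) where

    telescope : ∀ N l → n₀ ℕ.≤ N → ∣ f (l ℕ.+ N) - f N ∣ ≤ c N - c (l ℕ.+ N)
    telescope N zero n₀≤N = ℚ.≤-reflexive (trans (cong ∣_∣ (ℚ.+-inverseʳ (f N))) (sym (ℚ.+-inverseʳ (c N))))
    telescope N (suc l) n₀≤N = begin
      ∣ f (suc M) - f N ∣                      ≤⟨ triangle (f (suc M)) (f M) (f N) ⟩
      ∣ f (suc M) - f M ∣ + ∣ f M - f N ∣      ≤⟨ ℚ.+-mono-≤ (step M (ℕ.≤-trans n₀≤N (ℕ.m≤n+m N l)))
                                                            (telescope N l n₀≤N) ⟩
      (c M - c (suc M)) + (c N - c M)          ≡⟨ solve 3 (λ a b d → (a :- b) :+ (d :- a) := d :- b) refl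
                                                    (c M) (c (suc M)) (c N) ⟩
      c N - c (suc M)                          ∎
      where M = l ℕ.+ N

    near : ∀ N n → n₀ ℕ.≤ N → N ℕ.≤ n → ∣ f n - f N ∣ ≤ c N
    near N n n₀≤N N≤n = begin
      ∣ f n - f N ∣                ≡⟨ cong (λ k → ∣ f k - f N ∣) (sym (ℕ.m∸n+n≡m N≤n)) ⟩
      ∣ f (n ℕ.∸ N ℕ.+ N) - f N ∣  ≤⟨ telescope N (n ℕ.∸ N) n₀≤N ⟩
      c N - c (n ℕ.∸ N ℕ.+ N)      ≤⟨ ℚ.+-monoʳ-≤ (c N) (ℚ.neg-antimono-≤ (c≥0 (n ℕ.∸ N ℕ.+ N))) ⟩
      c N + 0ℚ                     ≡⟨ ℚ.+-identityʳ (c N) ⟩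
      c N                          ∎

    close : ∀ N m n → n₀ ℕ.≤ N → N ℕ.≤ m → N ℕ.≤ n → ∣ f m - f n ∣ ≤ c N + c N
    close N m n n₀≤N N≤m N≤n = begin
      ∣ f m - f n ∣                  ≤⟨ triangle (f m) (f N) (f n) ⟩
      ∣ f m - f N ∣ + ∣ f N - f n ∣  ≡⟨ cong (λ z → ∣ f m - f N ∣ + z) (-∣-∣ (f N) (f n)) ⟩
      ∣ f m - f N ∣ + ∣ f n - f N ∣  ≤⟨ ℚ.+-mono-≤ (near N m n₀≤N N≤m) (near N n n₀≤N N≤n) ⟩
      c N + c N                      ∎

open ℚ-Lemmas

-- Reals are Cauchy sequences of rationals; two sequences denote the same real
-- when _≤ᴿ_ holds in both directions.
Cauchy : (ℕ → ℚ) → Set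
Cauchy f = ∀ ε .{{_ : Positive ε}} → ∃ λ N → ∀ m n → N ℕ.≤ m → N ℕ.≤ n → ∣ f m ℚ.- f n ∣ ℚ.≤ ε

record ℝ : Set where
  constructor mkℝ
  field
    approx : ℕ → ℚ
    cauchy : Cauchy approx

open ℝ public

infix 4 _≤ᴿ_ _<ᴿ_

_≤ᴿ_ _<ᴿ_ : ℝ → ℝ → Set
x ≤ᴿ y = ∀ ε .{{_ : Positive ε}} → ∃ λ N → ∀ n → N ℕ.≤ n → approx x n ℚ.≤ approx y n ℚ.+ ε
x <ᴿ y = ∃ λ δ → Positive δ × ∃ λ N → ∀ n → N ℕ.≤ n → approx x n ℚ.+ δ ℚ.≤ approx y n

Cauchyᴿ : (ℕ → ℝ) → Set
Cauchyᴿ x = ∀ ε .{{_ : Positive ε}} → ∃ λ N → ∀ m n → N ℕ.≤ m → N ℕ.≤ n →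
  ∃ λ I → ∀ i → I ℕ.≤ i → ∣ approx (x m) i ℚ.- approx (x n) i ∣ ℚ.≤ ε

module _ where
  open ℚ-base using (_+_; _*_; _-_; -_; _≤_; _<_; _⊔_; 1/_)
  open ℚ.≤-Reasoning
  open +-*-Solver

  fromℚ : ℚ → ℝ
  fromℚ q = mkℝ (λ _ → q) λ ε → 0 , λ _ _ _ _ → begin
    ∣ q - q ∣  ≡⟨ cong ∣_∣ (ℚ.+-inverseʳ q) ⟩
    0ℚ         ≤⟨ ℚ.<⇒≤ (ℚ.positive⁻¹ ε) ⟩
    ε          ∎

  infixl 6 _+ᴿ_ _-ᴿ_
  infixl 7 _*ᴿ_
  infix  8 -ᴿ_

  _+ᴿ_ : ℝ → ℝ → ℝ
  x +ᴿ y = mkℝ (λ n → approx x n + approx y n) λ ε →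
    let M , hx = cauchy x (½ * ε) {{half-pos ε}}
        N , hy = cauchy y (½ * ε) {{half-pos ε}}
    in M ℕ.⊔ N , λ m n ≤m ≤n →
      let a = approx x m ; b = approx y m ; a′ = approx x n ; b′ = approx y n in begin
      ∣ (a + b) - (a′ + b′) ∣    ≡⟨ cong ∣_∣ (solve 4 (λ a b a′ b′ →
                                      (a :+ b) :- (a′ :+ b′) := (a :- a′) :+ (b :- b′)) refl a b a′ b′) ⟩
      ∣ (a - a′) + (b - b′) ∣    ≤⟨ ℚ.∣p+q∣≤∣p∣+∣q∣ (a - a′) (b - b′) ⟩
      ∣ a - a′ ∣ + ∣ b - b′ ∣    ≤⟨ ℚ.+-mono-≤
                                      (hx m n (ℕ.m⊔n≤o⇒m≤o M N ≤m) (ℕ.m⊔n≤o⇒m≤o M N ≤n))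
                                      (hy m n (ℕ.m⊔n≤o⇒n≤o M N ≤m) (ℕ.m⊔n≤o⇒n≤o M N ≤n)) ⟩
      ½ * ε + ½ * ε              ≡⟨ halves ε ⟩
      ε                          ∎

  -ᴿ_ : ℝ → ℝ
  -ᴿ x = mkℝ (λ n → - approx x n) λ ε →
    let N , h = cauchy x ε
    in N , λ m n ≤m ≤n → let a = approx x m ; a′ = approx x n in begin
      ∣ - a - - a′ ∣  ≡⟨ cong ∣_∣ (solve 2 (λ a a′ → :- a :- :- a′ := a′ :- a) refl a a′) ⟩
      ∣ a′ - a ∣      ≤⟨ h n m ≤n ≤m ⟩
      ε               ∎

  _-ᴿ_ : ℝ → ℝ → ℝ
  x -ᴿ y = x +ᴿ -ᴿ y

  bounded : ∀ x → ∃ λ B → ∃ λ N → ∀ n → N ℕ.≤ n → ∣ approx x n ∣ ≤ + suc B / 1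
  bounded x with cauchy x 1ℚ
  ... | N , h with ceiling (1ℚ + ∣ approx x N ∣)
  ... | B , le = B , N , λ n N≤n → let a = approx x n ; b = approx x N in begin
    ∣ a ∣              ≡⟨ cong ∣_∣ (solve 2 (λ a b → a := (a :- b) :+ b) refl a b) ⟩
    ∣ (a - b) + b ∣    ≤⟨ ℚ.∣p+q∣≤∣p∣+∣q∣ (a - b) b ⟩
    ∣ a - b ∣ + ∣ b ∣  ≤⟨ ℚ.+-monoˡ-≤ ∣ b ∣ (h n N N≤n ℕ.≤-refl) ⟩
    1ℚ + ∣ b ∣         ≤⟨ le ⟩
    + B / 1            ≤⟨ /-mono B (suc B) 0 0 (ℕ.*-monoˡ-≤ 1 (ℕ.n≤1+n B)) ⟩
    + suc B / 1        ∎

  suc/1-pos : ∀ n → Positive (+ suc n / 1)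
  suc/1-pos n = ℚ.normalize-pos (suc n) 1

  -- K · (ε / 2K) = ε / 2
  scale : ∀ B ε → (+ suc B / 1) * ((+ 1 / suc B) * (½ * ε)) ≡ ½ * ε
  scale B ε = begin-equality
    K * (R * (½ * ε))  ≡⟨ sym (ℚ.*-assoc K R (½ * ε)) ⟩
    (K * R) * (½ * ε)  ≡⟨ cong (_* (½ * ε)) (trans (/-* (suc B) B) one) ⟩
    1ℚ * (½ * ε)       ≡⟨ ℚ.*-identityˡ (½ * ε) ⟩
    ½ * ε              ∎
    where
    K = + suc B / 1
    R = + 1 / suc B
    one : + suc B / suc B ≡ 1ℚ
    one = ℚ.≤-antisym (/-mono (suc B) 1 B 0 (ℕ.≤-reflexive (ℕ.*-comm (suc B) 1)))
                      (/-mono 1 (suc B) 0 B (ℕ.≤-reflexive (ℕ.*-comm 1 (suc B))))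

  _*ᴿ_ : ℝ → ℝ → ℝ
  x *ᴿ y = mkℝ (λ n → approx x n * approx y n) prf
    where
    prf : Cauchy (λ n → approx x n * approx y n)
    prf ε = L , λ m n ≤m ≤n →
      let a = approx x m ; b = approx y m ; a′ = approx x n ; b′ = approx y n in begin
      ∣ a * b - a′ * b′ ∣                      ≡⟨ cong ∣_∣ (solve 4 (λ a b a′ b′ →
                                                    a :* b :- a′ :* b′ := a :* (b :- b′) :+ b′ :* (a :- a′))
                                                    refl a b a′ b′) ⟩
      ∣ a * (b - b′) + b′ * (a - a′) ∣         ≤⟨ ℚ.∣p+q∣≤∣p∣+∣q∣ (a * (b - b′)) (b′ * (a - a′)) ⟩
      ∣ a * (b - b′) ∣ + ∣ b′ * (a - a′) ∣     ≡⟨ cong₂ _+_ (ℚ.∣p*q∣≡∣p∣*∣q∣ a (b - b′)) (ℚ.∣p*q∣≡∣p∣*∣q∣ b′ (a - a′)) ⟩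
      ∣ a ∣ * ∣ b - b′ ∣ + ∣ b′ ∣ * ∣ a - a′ ∣ ≤⟨ ℚ.+-mono-≤
          (*-mono (0≤/1 A) (ℚ.0≤∣p∣ (b - b′)) (ha m (≤L₁ ≤m)) (hy m n (≤L₄ ≤m) (≤L₄ ≤n)))
          (*-mono (0≤/1 B) (ℚ.0≤∣p∣ (a - a′)) (hb n (≤L₂ ≤n)) (hx m n (≤L₃ ≤m) (≤L₃ ≤n))) ⟩
      (+ suc A / 1) * εy + (+ suc B / 1) * εx  ≡⟨ cong₂ _+_ (scale A ε) (scale B ε) ⟩
      ½ * ε + ½ * ε                            ≡⟨ halves ε ⟩
      ε                                        ∎
      where
      A  = proj₁ (bounded x)
      B  = proj₁ (bounded y)
      M₁ = proj₁ (proj₂ (bounded x))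
      M₂ = proj₁ (proj₂ (bounded y))
      ha = proj₂ (proj₂ (bounded x))
      hb = proj₂ (proj₂ (bounded y))
      εx = (+ 1 / suc B) * (½ * ε)
      εy = (+ 1 / suc A) * (½ * ε)
      instance
        εx-pos : Positive εx
        εx-pos = ℚ.pos*pos⇒pos (+ 1 / suc B) {{/-pos {B}}} (½ * ε) {{half-pos ε}}
        εy-pos : Positive εy
        εy-pos = ℚ.pos*pos⇒pos (+ 1 / suc A) {{/-pos {A}}} (½ * ε) {{half-pos ε}}
      M₃ = proj₁ (cauchy x εx)
      M₄ = proj₁ (cauchy y εy)
      hx = proj₂ (cauchy x εx)
      hy = proj₂ (cauchy y εy)
      L = (M₁ ℕ.⊔ M₂) ℕ.⊔ (M₃ ℕ.⊔ M₄)
      0≤/1 : ∀ C → 0ℚ ≤ + suc C / 1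
      0≤/1 C = ℚ.<⇒≤ (ℚ.positive⁻¹ (+ suc C / 1) {{suc/1-pos C}})
      ≤L₁ : ∀ {n} → L ℕ.≤ n → M₁ ℕ.≤ n
      ≤L₁ = ℕ.m⊔n≤o⇒m≤o M₁ M₂ ∘ ℕ.m⊔n≤o⇒m≤o (M₁ ℕ.⊔ M₂) (M₃ ℕ.⊔ M₄)
      ≤L₂ : ∀ {n} → L ℕ.≤ n → M₂ ℕ.≤ n
      ≤L₂ = ℕ.m⊔n≤o⇒n≤o M₁ M₂ ∘ ℕ.m⊔n≤o⇒m≤o (M₁ ℕ.⊔ M₂) (M₃ ℕ.⊔ M₄)
      ≤L₃ : ∀ {n} → L ℕ.≤ n → M₃ ℕ.≤ n
      ≤L₃ = ℕ.m⊔n≤o⇒m≤o M₃ M₄ ∘ ℕ.m⊔n≤o⇒n≤o (M₁ ℕ.⊔ M₂) (M₃ ℕ.⊔ M₄)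
      ≤L₄ : ∀ {n} → L ℕ.≤ n → M₄ ℕ.≤ n
      ≤L₄ = ℕ.m⊔n≤o⇒n≤o M₃ M₄ ∘ ℕ.m⊔n≤o⇒n≤o (M₁ ℕ.⊔ M₂) (M₃ ℕ.⊔ M₄)

  0ℝ 1ℝ : ℝ
  0ℝ = fromℚ 0ℚ
  1ℝ = fromℚ 1ℚ

  fromℕ : ℕ → ℝ
  fromℕ n = fromℚ (+ n / 1)

  x<y⇒0<y-x : ∀ {x y} → x <ᴿ y → 0ℝ <ᴿ y -ᴿ x
  x<y⇒0<y-x {x} {y} (δ , δ>0 , N , h) = δ , δ>0 , N , λ n N≤n →
    let a = approx x n ; b = approx y n in begin
    0ℚ + δ       ≡⟨ solve 2 (λ a δ → con 0ℚ :+ δ := (a :+ δ) :- a) refl a δ ⟩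
    (a + δ) - a  ≤⟨ ℚ.+-monoˡ-≤ (- a) (h n N≤n) ⟩
    b - a        ∎

  -- The reciprocal of a positive real: if x ≥ δ > 0 eventually, then replacing
  -- the approximations of x by their maximum with δ does not change x.
  recip : (x : ℝ) → 0ℝ <ᴿ x → ℝ
  recip x (δ , δ>0 , N , x≥δ) = mkℝ inv prf
    where
    a : ℕ → ℚ
    a n = approx x n ⊔ δ

    a-pos : ∀ n → Positive (a n)
    a-pos n = positive (ℚ.<-≤-trans (ℚ.positive⁻¹ δ {{δ>0}}) (ℚ.p≤q⊔p (approx x n) δ))

    inv : ℕ → ℚ
    inv n = (1/ a n) {{ℚ.pos⇒nonZero (a n) {{a-pos n}}}}

    d : ℚ
    d = (1/ δ) {{ℚ.pos⇒nonZero δ {{δ>0}}}}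

    inv-pos : ∀ n → Positive (inv n)
    inv-pos n = ℚ.1/pos⇒pos (a n) {{a-pos n}}

    d-pos : Positive d
    d-pos = ℚ.1/pos⇒pos δ {{δ>0}}

    inverse : ∀ n → a n * inv n ≡ 1ℚ
    inverse n = ℚ.*-inverseʳ (a n) {{ℚ.pos⇒nonZero (a n) {{a-pos n}}}}

    inv≤d : ∀ n → inv n ≤ d
    inv≤d n = begin
      inv n                  ≡⟨ sym (ℚ.*-identityˡ (inv n)) ⟩
      1ℚ * inv n             ≡⟨ cong (_* inv n) (sym (ℚ.*-inverseˡ δ {{ℚ.pos⇒nonZero δ {{δ>0}}}})) ⟩
      (d * δ) * inv n        ≤⟨ ℚ.*-monoʳ-≤-nonNeg (inv n) {{ℚ.pos⇒nonNeg (inv n) {{inv-pos n}}}}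
                                  (ℚ.*-monoˡ-≤-nonNeg d {{ℚ.pos⇒nonNeg d {{d-pos}}}} (ℚ.p≤q⊔p (approx x n) δ)) ⟩
      (d * a n) * inv n      ≡⟨ ℚ.*-assoc d (a n) (inv n) ⟩
      d * (a n * inv n)      ≡⟨ cong (d *_) (inverse n) ⟩
      d * 1ℚ                 ≡⟨ ℚ.*-identityʳ d ⟩
      d                      ∎

    a≡ : ∀ n → N ℕ.≤ n → a n ≡ approx x n
    a≡ n N≤n = ℚ.p≥q⇒p⊔q≡p (subst (_≤ approx x n) (ℚ.+-identityˡ δ) (x≥δ n N≤n))

    difference : ∀ m n → inv m - inv n ≡ (a n - a m) * (inv m * inv n)
    difference m n = begin-equality
      u - v                          ≡⟨ cong₂ _-_ (sym (ℚ.*-identityʳ u)) (sym (ℚ.*-identityʳ v)) ⟩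
      u * 1ℚ - v * 1ℚ                ≡⟨ cong₂ (λ s t → u * s - v * t) (sym (inverse n)) (sym (inverse m)) ⟩
      u * (a n * v) - v * (a m * u)  ≡⟨ solve 4 (λ u v p q → u :* (q :* v) :- v :* (p :* u) := (q :- p) :* (u :* v))
                                          refl u v (a m) (a n) ⟩
      (a n - a m) * (u * v)          ∎
      where
      u = inv m
      v = inv n

    prf : Cauchy inv
    prf ε = N ℕ.⊔ proj₁ (cauchy x ε′) , λ m n ≤m ≤n → begin
      ∣ inv m - inv n ∣                            ≡⟨ cong ∣_∣ (difference m n) ⟩
      ∣ (a n - a m) * (inv m * inv n) ∣            ≡⟨ ℚ.∣p*q∣≡∣p∣*∣q∣ (a n - a m) (inv m * inv n) ⟩
      ∣ a n - a m ∣ * ∣ inv m * inv n ∣            ≡⟨ cong₂ (λ s t → ∣ s ∣ * t)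
                                                        (cong₂ _-_ (a≡ n (ℕ.m⊔n≤o⇒m≤o N _ ≤n)) (a≡ m (ℕ.m⊔n≤o⇒m≤o N _ ≤m)))
                                                        (ℚ.0≤p⇒∣p∣≡p (0≤uv m n)) ⟩
      ∣ approx x n - approx x m ∣ * (inv m * inv n) ≤⟨ *-mono (ℚ.<⇒≤ (ℚ.positive⁻¹ ε′)) (0≤uv m n)
                                                        (proj₂ (cauchy x ε′) n m (ℕ.m⊔n≤o⇒n≤o N _ ≤n) (ℕ.m⊔n≤o⇒n≤o N _ ≤m))
                                                        (*-mono (0≤d) (0≤u n) (inv≤d m) (inv≤d n)) ⟩
      (ε * (δ * δ)) * (d * d)                      ≡⟨ solve 3 (λ ε δ d → (ε :* (δ :* δ)) :* (d :* d) := ε :* ((δ :* d) :* (δ :* d)))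
                                                        refl ε δ d ⟩
      ε * ((δ * d) * (δ * d))                      ≡⟨ cong (λ z → ε * (z * z)) (ℚ.*-inverseʳ δ {{ℚ.pos⇒nonZero δ {{δ>0}}}}) ⟩
      ε * 1ℚ                                       ≡⟨ ℚ.*-identityʳ ε ⟩
      ε                                            ∎
      where
      ε′ = ε * (δ * δ)
      instance
        ε′-pos : Positive ε′
        ε′-pos = ℚ.pos*pos⇒pos ε (δ * δ) {{ℚ.pos*pos⇒pos δ {{δ>0}} δ {{δ>0}}}}
      0≤d : 0ℚ ≤ d
      0≤d = ℚ.<⇒≤ (ℚ.positive⁻¹ d {{d-pos}})
      0≤u : ∀ n → 0ℚ ≤ inv n
      0≤u n = ℚ.<⇒≤ (ℚ.positive⁻¹ (inv n) {{inv-pos n}})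
      0≤uv : ∀ m n → 0ℚ ≤ inv m * inv n
      0≤uv m n = ℚ.<⇒≤ (ℚ.positive⁻¹ (inv m * inv n) {{ℚ.pos*pos⇒pos (inv m) {{inv-pos m}} (inv n) {{inv-pos n}}}})

  -- The limit of a Cauchy sequence of reals: its n-th approximation is an
  -- approximation of x n that is correct to within 1/(n+1).
  lim : (x : ℕ → ℝ) → Cauchyᴿ x → ℝ
  lim x x-cauchy = mkℝ y prf
    where
    modulus : ℕ → ℕ
    modulus n = proj₁ (cauchy (x n) (+ 1 / suc n) {{/-pos {n}}})

    y : ℕ → ℚ
    y n = approx (x n) (modulus n)

    y-near : ∀ n i → modulus n ℕ.≤ i → ∣ y n - approx (x n) i ∣ ≤ + 1 / suc n
    y-near n i = proj₂ (cauchy (x n) (+ 1 / suc n) {{/-pos {n}}}) (modulus n) i ℕ.≤-refl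

    prf : Cauchy y
    prf ε = N₁ ℕ.⊔ N₂ , λ m n ≤m ≤n →
      let I , hI = proj₂ (x-cauchy (½ * ε) {{half-pos ε}}) m n (ℕ.m⊔n≤o⇒m≤o N₁ N₂ ≤m) (ℕ.m⊔n≤o⇒m≤o N₁ N₂ ≤n)
          i  = I ℕ.⊔ (modulus m ℕ.⊔ modulus n)
          I≤ = ℕ.m≤m⊔n I (modulus m ℕ.⊔ modulus n)
          m≤ = ℕ.≤-trans (ℕ.m≤m⊔n (modulus m) (modulus n)) (ℕ.m≤n⊔m I _)
          n≤ = ℕ.≤-trans (ℕ.m≤n⊔m (modulus m) (modulus n)) (ℕ.m≤n⊔m I _)
          p  = approx (x m) i
          q  = approx (x n) i
      in begin
      ∣ y m - y n ∣                                ≤⟨ triangle (y m) p (y n) ⟩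
      ∣ y m - p ∣ + ∣ p - y n ∣                    ≤⟨ ℚ.+-monoʳ-≤ ∣ y m - p ∣ (triangle p q (y n)) ⟩
      ∣ y m - p ∣ + (∣ p - q ∣ + ∣ q - y n ∣)      ≡⟨ cong (λ z → ∣ y m - p ∣ + (∣ p - q ∣ + z)) (-∣-∣ q (y n)) ⟩
      ∣ y m - p ∣ + (∣ p - q ∣ + ∣ y n - q ∣)      ≤⟨ ℚ.+-mono-≤ (within m i m≤ (ℕ.m⊔n≤o⇒n≤o N₁ N₂ ≤m))
                                                        (ℚ.+-mono-≤ (hI i I≤) (within n i n≤ (ℕ.m⊔n≤o⇒n≤o N₁ N₂ ≤n))) ⟩
      ½ * (½ * ε) + (½ * ε + ½ * (½ * ε))          ≡⟨ solve 1 (λ ε → con ½ :* (con ½ :* ε) :+ (con ½ :* ε :+ con ½ :* (con ½ :* ε)) := ε)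
                                                        refl ε ⟩
      ε                                            ∎
      where
      N₁ = proj₁ (x-cauchy (½ * ε) {{half-pos ε}})
      N₂ = proj₁ (archimedean 1ℚ (½ * (½ * ε)) {{half-pos (½ * ε) {{half-pos ε}}}})
      within : ∀ n i → modulus n ℕ.≤ i → N₂ ℕ.≤ n → ∣ y n - approx (x n) i ∣ ≤ ½ * (½ * ε)
      within n i ≤i N₂≤n = begin
        ∣ y n - approx (x n) i ∣  ≤⟨ y-near n i ≤i ⟩
        + 1 / suc n               ≡⟨ sym (ℚ.*-identityˡ (+ 1 / suc n)) ⟩
        1ℚ * (+ 1 / suc n)        ≤⟨ proj₂ (archimedean 1ℚ (½ * (½ * ε)) {{half-pos (½ * ε) {{half-pos ε}}}}) n N₂≤n ⟩
        ½ * (½ * ε)               ∎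

-- expTerm x n = xⁿ/n!
expTerm : ℝ → ℕ → ℝ
expTerm x zero    = 1ℝ
expTerm x (suc n) = expTerm x n *ᴿ x *ᴿ fromℚ (+ 1 / suc n)

-- expSum x n = Σ_{j<n} xʲ/j!, the n-th partial sum of the power series of exp
expSum : ℝ → ℕ → ℝ
expSum x zero    = 0ℝ
expSum x (suc n) = expSum x n +ᴿ expTerm x n

H : ℕ → ℚ
H zero    = 0ℚ
H (suc n) = H n ℚ.+ + 1 / suc n

module _ where
  open ℚ-base using (_+_; _*_; _-_; -_; _≤_; _<_; _⊔_; 1/_)
  open ℚ.≤-Reasoning
  open +-*-Solver

  expSum-cauchy : ∀ x → Cauchyᴿ (expSum x)
  expSum-cauchy x ε = N , λ m n ≤m ≤n → I , λ i I≤i →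
    let open Bounds i I≤i in begin
    ∣ approx (expSum x m) i - approx (expSum x n) i ∣ ≤⟨ close N m n n₀≤N ≤m ≤n ⟩
    c N + c N                                        ≤⟨ ℚ.+-mono-≤ cN≤ cN≤ ⟩
    ½ * ε + ½ * ε                                    ≡⟨ halves ε ⟩
    ε                                                ∎
    where
    B = suc (proj₁ (bounded x))
    I = proj₁ (proj₂ (bounded x))
    K = + B / 1

    -- b n = Bⁿ/n!
    b : ℕ → ℚ
    b zero    = 1ℚ
    b (suc n) = b n * K * (+ 1 / suc n)

    b≥0 : ∀ n → 0ℚ ≤ b n
    b≥0 n = ℚ.<⇒≤ (ℚ.positive⁻¹ (b n) {{b>0 n}})
      where
      b>0 : ∀ n → Positive (b n)
      b>0 zero    = _
      b>0 (suc n) = ℚ.pos*pos⇒pos (b n * K)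
        {{ℚ.pos*pos⇒pos (b n) {{b>0 n}} K {{suc/1-pos (proj₁ (bounded x))}}}}
        (+ 1 / suc n) {{/-pos {n}}}

    c : ℕ → ℚ
    c n = b n + b n

    c≥0 : ∀ n → 0ℚ ≤ c n
    c≥0 n = ℚ.+-mono-≤ (b≥0 n) (b≥0 n)

    n₀ = B ℕ.* 2

    halving : ∀ n → n₀ ℕ.≤ n → b (suc n) ≤ b n * ½
    halving n n₀≤n = begin
      b n * K * (+ 1 / suc n)    ≡⟨ ℚ.*-assoc (b n) K (+ 1 / suc n) ⟩
      b n * (K * (+ 1 / suc n))  ≡⟨ cong (b n *_) (/-* B n) ⟩
      b n * (+ B / suc n)        ≤⟨ ℚ.*-monoˡ-≤-nonNeg (b n) {{nonNegative (b≥0 n)}}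
                                      (/-mono B 1 n 1 (ℕ.≤-trans n₀≤n (ℕ.≤-trans (ℕ.n≤1+n n) (ℕ.m≤m+n (suc n) 0)))) ⟩
      b n * ½                    ∎

    decreasing : ∀ n → n₀ ℕ.≤ n → c (suc n) ≤ b n
    decreasing n n₀≤n = begin
      b (suc n) + b (suc n)  ≤⟨ ℚ.+-mono-≤ (halving n n₀≤n) (halving n n₀≤n) ⟩
      b n * ½ + b n * ½      ≡⟨ solve 1 (λ b → b :* con ½ :+ b :* con ½ := b) refl (b n) ⟩
      b n                    ∎

    b≤ : ∀ l → b (l ℕ.+ n₀) ≤ b n₀
    b≤ zero    = ℚ.≤-refl
    b≤ (suc l) = begin
      b (suc (l ℕ.+ n₀))                        ≡⟨ sym (ℚ.+-identityʳ _) ⟩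
      b (suc (l ℕ.+ n₀)) + 0ℚ                   ≤⟨ ℚ.+-monoʳ-≤ (b (suc (l ℕ.+ n₀))) (b≥0 (suc (l ℕ.+ n₀))) ⟩
      c (suc (l ℕ.+ n₀))                        ≤⟨ decreasing (l ℕ.+ n₀) (ℕ.m≤n+m n₀ l) ⟩
      b (l ℕ.+ n₀)                              ≤⟨ b≤ l ⟩
      b n₀                                      ∎

    arch = archimedean (b n₀ * K + b n₀ * K) (½ * ε) {{half-pos ε}}
    L = proj₁ arch
    N = suc (L ℕ.+ n₀)

    n₀≤N : n₀ ℕ.≤ N
    n₀≤N = ℕ.≤-trans (ℕ.m≤n+m n₀ L) (ℕ.n≤1+n _)

    cN≤ : c N ≤ ½ * ε
    cN≤ = begin
      b M * K * R + b M * K * R    ≤⟨ ℚ.+-mono-≤ le le ⟩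
      b n₀ * K * R + b n₀ * K * R  ≡⟨ sym (ℚ.*-distribʳ-+ R (b n₀ * K) (b n₀ * K)) ⟩
      (b n₀ * K + b n₀ * K) * R    ≤⟨ proj₂ arch M (ℕ.m≤m+n L n₀) ⟩
      ½ * ε                        ∎
      where
      M = L ℕ.+ n₀
      R = + 1 / suc M
      le : b M * K * R ≤ b n₀ * K * R
      le = ℚ.*-monoʳ-≤-nonNeg R {{/-nonNeg {1} {M}}}
             (ℚ.*-monoʳ-≤-nonNeg K {{/-nonNeg {B} {0}}} (b≤ L))

    module Bounds (i : ℕ) (I≤i : I ℕ.≤ i) where
      term≤ : ∀ n → ∣ approx (expTerm x n) i ∣ ≤ b n
      term≤ zero    = ℚ.≤-refl
      term≤ (suc n) = begin
        ∣ t * q * R ∣          ≡⟨ ℚ.∣p*q∣≡∣p∣*∣q∣ (t * q) R ⟩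
        ∣ t * q ∣ * ∣ R ∣      ≡⟨ cong₂ _*_ (ℚ.∣p*q∣≡∣p∣*∣q∣ t q)
                                    (ℚ.0≤p⇒∣p∣≡p (ℚ.nonNegative⁻¹ R {{/-nonNeg {1} {n}}})) ⟩
        ∣ t ∣ * ∣ q ∣ * R      ≤⟨ ℚ.*-monoʳ-≤-nonNeg R {{/-nonNeg {1} {n}}}
                                    (*-mono (b≥0 n) (ℚ.0≤∣p∣ q) (term≤ n) (proj₂ (proj₂ (bounded x)) i I≤i)) ⟩
        b n * K * R            ∎
        where
        t = approx (expTerm x n) i
        q = approx x i
        R = + 1 / suc n

      step : ∀ n → n₀ ℕ.≤ n →
             ∣ approx (expSum x (suc n)) i - approx (expSum x n) i ∣ ≤ c n - c (suc n)
      step n n₀≤n = begin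
        ∣ (s + t) - s ∣    ≡⟨ cong ∣_∣ (solve 2 (λ s t → (s :+ t) :- s := t) refl s t) ⟩
        ∣ t ∣              ≤⟨ term≤ n ⟩
        b n                ≡⟨ solve 1 (λ b → b := (b :+ b) :- b) refl (b n) ⟩
        c n - b n          ≤⟨ ℚ.+-monoʳ-≤ (c n) (ℚ.neg-antimono-≤ (decreasing n n₀≤n)) ⟩
        c n - c (suc n)    ∎
        where
        s = approx (expSum x n) i
        t = approx (expTerm x n) i

      open Telescope (λ n → approx (expSum x n) i) c n₀ c≥0 step public

  block-lower : ∀ a b n → a ℕ.+ n ℕ.≤ suc b → + n / suc b ≤ H (a ℕ.+ n) - H a
  block-lower a b zero    _ = begin
    + 0 / suc b          ≡⟨ ℚ.0/n≡0 (suc b) ⟩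
    0ℚ                   ≡⟨ sym (ℚ.+-inverseʳ (H a)) ⟩
    H a - H a            ≡⟨ cong (λ k → H k - H a) (sym (ℕ.+-identityʳ a)) ⟩
    H (a ℕ.+ 0) - H a    ∎
  block-lower a b (suc n) le = begin
    + suc n / suc b                             ≡⟨ sym (/-suc n b) ⟩
    + n / suc b + + 1 / suc b                   ≤⟨ ℚ.+-mono-≤ (block-lower a b n (ℕ.<⇒≤ lt))
                                                     (/-mono 1 1 b (a ℕ.+ n) (ℕ.*-monoʳ-≤ 1 lt)) ⟩
    (H (a ℕ.+ n) - H a) + + 1 / suc (a ℕ.+ n)   ≡⟨ solve 3 (λ p q r → (p :- q) :+ r := (p :+ r) :- q) refl
                                                     (H (a ℕ.+ n)) (H a) (+ 1 / suc (a ℕ.+ n)) ⟩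
    H (suc (a ℕ.+ n)) - H a                     ≡⟨ cong (λ k → H k - H a) (sym (ℕ.+-suc a n)) ⟩
    H (a ℕ.+ suc n) - H a                       ∎
    where
    lt : suc (a ℕ.+ n) ℕ.≤ suc b
    lt = subst (ℕ._≤ suc b) (ℕ.+-suc a n) le

  block-upper : ∀ a n → H (a ℕ.+ n) - H a ≤ + n / suc a
  block-upper a zero    = begin
    H (a ℕ.+ 0) - H a    ≡⟨ cong (λ k → H k - H a) (ℕ.+-identityʳ a) ⟩
    H a - H a            ≡⟨ ℚ.+-inverseʳ (H a) ⟩
    0ℚ                   ≡⟨ sym (ℚ.0/n≡0 (suc a)) ⟩
    + 0 / suc a          ∎
  block-upper a (suc n) = begin
    H (a ℕ.+ suc n) - H a                       ≡⟨ cong (λ k → H k - H a) (ℕ.+-suc a n) ⟩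
    H (suc (a ℕ.+ n)) - H a                     ≡⟨ solve 3 (λ p q r → (p :+ r) :- q := (p :- q) :+ r) refl
                                                     (H (a ℕ.+ n)) (H a) (+ 1 / suc (a ℕ.+ n)) ⟩
    (H (a ℕ.+ n) - H a) + + 1 / suc (a ℕ.+ n)   ≤⟨ ℚ.+-mono-≤ (block-upper a n)
                                                     (/-mono 1 1 (a ℕ.+ n) a (ℕ.*-monoʳ-≤ 1 (ℕ.s≤s (ℕ.m≤m+n a n)))) ⟩
    + n / suc a + + 1 / suc a                   ≡⟨ /-suc n a ⟩
    + suc n / suc a                             ∎

  -- 1/(n+1) ≤ 1/(nk+1) + ⋯ + 1/(nk+k) ≤ 1/n
  module Block (k′ n′ : ℕ) where
    k = suc k′
    n = suc n′
    block = H (k ℕ.* suc n) - H (k ℕ.* n)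

    split : k ℕ.* n ℕ.+ k ≡ k ℕ.* suc n
    split = trans (ℕ.+-comm (k ℕ.* n) k) (sym (ℕ.*-suc k n))

    lower : + 1 / suc n ≤ block
    lower = begin
      + 1 / suc n                      ≤⟨ /-mono 1 k n (n ℕ.+ k′ ℕ.* suc n) (ℕ.≤-reflexive (ℕ.*-identityˡ _)) ⟩
      + k / (k ℕ.* suc n)              ≤⟨ block-lower (k ℕ.* n) _ k (ℕ.≤-reflexive split) ⟩
      H (k ℕ.* n ℕ.+ k) - H (k ℕ.* n)  ≡⟨ cong (λ j → H j - H (k ℕ.* n)) split ⟩
      block                            ∎

    upper : block ≤ + 1 / n
    upper = begin
      block                            ≡⟨ cong (λ j → H j - H (k ℕ.* n)) (sym split) ⟩
      H (k ℕ.* n ℕ.+ k) - H (k ℕ.* n)  ≤⟨ block-upper (k ℕ.* n) k ⟩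
      + k / suc (k ℕ.* n)              ≤⟨ /-mono k 1 (k ℕ.* n) n′ (ℕ.≤-trans (ℕ.n≤1+n _) (ℕ.≤-reflexive (sym (ℕ.*-identityˡ _)))) ⟩
      + 1 / n                          ∎

    excess : ∣ block - + 1 / suc n ∣ ≤ + 1 / n - + 1 / suc n
    excess = begin
      ∣ block - + 1 / suc n ∣  ≡⟨ ℚ.0≤p⇒∣p∣≡p (subst (_≤ block - + 1 / suc n) (ℚ.+-inverseʳ (+ 1 / suc n))
                                                 (ℚ.+-monoˡ-≤ (- (+ 1 / suc n)) lower)) ⟩
      block - + 1 / suc n      ≤⟨ ℚ.+-monoˡ-≤ (- (+ 1 / suc n)) upper ⟩
      + 1 / n - + 1 / suc n    ∎

  1/ℕ : ℕ → ℚ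
  1/ℕ zero    = 0ℚ
  1/ℕ (suc n) = + 1 / suc n

  1/ℕ≥0 : ∀ n → 0ℚ ≤ 1/ℕ n
  1/ℕ≥0 zero    = ℚ.≤-refl
  1/ℕ≥0 (suc n) = ℚ.<⇒≤ (ℚ.positive⁻¹ (+ 1 / suc n) {{/-pos {n}}})

  1/ℕ-small : ∀ ε .{{_ : Positive ε}} → ∃ λ N → 1/ℕ (suc N) + 1/ℕ (suc N) ≤ ε
  1/ℕ-small ε = let N , h = archimedean (1ℚ + 1ℚ) ε in N ,
    subst (_≤ ε) (solve 1 (λ r → (con 1ℚ :+ con 1ℚ) :* r := r :+ r) refl (+ 1 / suc N)) (h N ℕ.≤-refl)

  logApprox : ℕ → ℕ → ℚ
  logApprox k m = H (k ℕ.* m) - H m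

  logApprox-cauchy : ∀ k .{{_ : ℕ.NonZero k}} → Cauchy (logApprox k)
  logApprox-cauchy k@(suc k′) ε = let N , h = 1/ℕ-small ε in suc N , λ m n ≤m ≤n →
    ℚ.≤-trans (close (suc N) m n (ℕ.s≤s ℕ.z≤n) ≤m ≤n) h
    where
    step : ∀ m → 1 ℕ.≤ m → ∣ logApprox k (suc m) - logApprox k m ∣ ≤ 1/ℕ m - 1/ℕ (suc m)
    step (suc m) _ = subst (λ z → ∣ z ∣ ≤ 1/ℕ (suc m) - 1/ℕ (suc (suc m)))
      (solve 4 (λ p q r s → (p :- q) :- s := (p :- (r :+ s)) :- (q :- r)) refl
        (H (k ℕ.* suc (suc m))) (H (k ℕ.* suc m)) (H (suc m)) (+ 1 / suc (suc m)))
      (Block.excess k′ m)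
    open Telescope (logApprox k) 1/ℕ 1 1/ℕ≥0 step

  exp : ℝ → ℝ
  exp x = lim (expSum x) (expSum-cauchy x)

  -- log k = ∫₁ᵏ dt/t, as the limit of the right Riemann sums of mesh 1/m:
  --   H (k m) − H m = Σ_{i=1}^{(k−1)m} (1/m) · 1/(1 + i/m)
  log : (k : ℕ) .{{_ : ℕ.NonZero k}} → ℝ
  log k = mkℝ (λ m → H (k ℕ.* m) - H m) (logApprox-cauchy k)

  H-log-cauchy : Cauchyᴿ (λ n → fromℚ (H (suc n)) -ᴿ log (suc n))
  H-log-cauchy ε = let N , h = 1/ℕ-small ε in N , λ m n ≤m ≤n → 1 , λ i 1≤i →
    let open Telescope (f i) 1/ℕ 1 1/ℕ≥0 (step i 1≤i) in
    ℚ.≤-trans (close (suc N) (suc m) (suc n) (ℕ.s≤s ℕ.z≤n) (ℕ.s≤s ≤m) (ℕ.s≤s ≤n)) h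
    where
    f : ℕ → ℕ → ℚ
    f i n = H n - (H (n ℕ.* i) - H i)
    step : ∀ i → 1 ℕ.≤ i → ∀ n → 1 ℕ.≤ n → ∣ f i (suc n) - f i n ∣ ≤ 1/ℕ n - 1/ℕ (suc n)
    step i@(suc i′) _ n@(suc n′) _ = begin
      ∣ f i (suc n) - f i n ∣                        ≡⟨ cong₂ (λ p q → ∣ (H (suc n) - (H p - H i)) - (H n - (H q - H i)) ∣)
                                                          (ℕ.*-comm (suc n) i) (ℕ.*-comm n i) ⟩
      ∣ (H n + r - (P - H i)) - (H n - (Q - H i)) ∣  ≡⟨ cong ∣_∣ (solve 5 (λ h r p q s →
                                                          (h :+ r :- (p :- s)) :- (h :- (q :- s)) := r :- (p :- q))
                                                          refl (H n) r P Q (H i)) ⟩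
      ∣ r - (P - Q) ∣                                ≡⟨ -∣-∣ r (P - Q) ⟩
      ∣ (P - Q) - r ∣                                ≤⟨ Block.excess i′ n′ ⟩
      1/ℕ n - 1/ℕ (suc n)                                ∎
      where
      r = + 1 / suc n
      P = H (i ℕ.* suc n)
      Q = H (i ℕ.* n)

  γ : ℝ
  γ = lim (λ n → fromℚ (H (suc n)) -ᴿ log (suc n)) H-log-cauchy

{-# OPTIONS --safe #-}

-- If every Gᵢ is coloured by cᵢ with colours 0, …, k, colour v by Σᵢ sᵢ cᵢ(vᵢ)
-- modulo N, where the products a sᵢ with 0 < |a| ≤ k are distinct modulo N.
-- The two colours of an edge then determine its direction i and the change of
-- cᵢ along it.  Hence a connected bichromatic subgraph lies in one copy of some
-- Gᵢ and is bichromatic under cᵢ, so it is not in 𝓕.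
--
-- For the first bound take sᵢ = k i + 1.  For the second, the integers coprime
-- to k! do not suffice for fixed k: their density ∏_{p ≤ k} (1 − 1/p) is for
-- instance 1/2 < e^(−γ) / log 2 when k = 2.  Working modulo N is more efficient:
-- 1 modulo 2k + 1 (and 1, 3, 4 modulo 13 when k = 2) lifts to families with
-- N ≈ (2k + 1) d (and N ≈ 13 d / 3), which is below 2 k d e^γ log k already by
-- the estimates γ ≥ 1/2, e^γ ≥ 8/5, log 2 ≥ 15/22 and log 3 ≥ 5/6.
module Submission where

open import Defs
open import Algebra.Bundles using (AbelianGroup)
open import Algebra.Properties.Group using (∙-cancelʳ)
open import Data.Fin.Base using (Fin; zero; suc; toℕ; fromℕ<; inject≤; quotient; remainder; combine)
import Data.Fin.Properties as Fin
open import Data.Integer.Base as ℤ using (ℤ; +_; -[1+_]; 0ℤ; ∣_∣)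
import Data.Integer.DivMod as ℤ
open import Data.Integer.Divisibility.Signed as ℤ using (divides)
import Data.Integer.Properties as ℤ
import Data.Integer.Tactic.RingSolver as ℤ
open import Data.Nat.Base as ℕ
  using (ℕ; zero; suc; pred; NonZero; _+_; _*_; _∸_; _≤_; _<_; _⊔_; _!; s≤s; z≤n)
open import Data.Nat.Coprimality using (Coprime; coprime-divisor)
import Data.Nat.Divisibility as ℕ
import Data.Nat.DivMod as ℕ
import Data.Nat.Properties as ℕ
import Data.Nat.Tactic.RingSolver as ℕ
open import Data.Product.Base using (∃; ∃₂; _×_; _,_; proj₁; proj₂)
open import Data.Rational.Base as ℚ using (ℚ; mkℚ; 0ℚ; 1ℚ; ½; _/_; Positive; positive)
import Data.Rational.Properties as ℚ
open import Data.Rational.Solver using (module +-*-Solver)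
open import Data.Sum.Base using (_⊎_; inj₁; inj₂)
open import Data.Unit.Base using (tt)
open import Data.Vec.Base using (Vec; []; _∷_; lookup)
open import Function.Base using (_∘_)
open import Function.Bundles using (Inverse; Injection; Equivalence; mk⇔)
open import Function.Definitions using (Injective)
open import Function.Properties.Inverse using (↔-sym; ↔⇒↣)
open import Relation.Binary.Construct.Closure.ReflexiveTransitive using (Star; _◅_) renaming (ε to done)
open import Relation.Binary.PropositionalEquality
open import Relation.Nullary.Decidable
  using (Dec; yes; no; _×-dec_; _→-dec_; ¬?; decidable-stable; from-yes)
open import Relation.Nullary.Negation using (¬_; contradiction)
open import Relation.Unary using (Pred; U)

open Graph using (V; order; Adj; V↔Fin)
open ℚ-Lemmas
open +-*-Solver using (solve; con; _:+_; _:*_; _:-_; _:=_)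

-- Counting values, and edges in connected graphs

three-values : ∀ {A : Set} {X : Pred A _} {x y z} → x ≢ y → x ≢ z → y ≢ z →
               X x → X y → X z → AtLeast 3 X
three-values {A} {X} {x} {y} {z} x≢y x≢z y≢z Xx Xy Xz = f , f-injective , f∈X
  where
  f : Fin 3 → A
  f zero             = x
  f (suc zero)       = y
  f (suc (suc zero)) = z

  f-injective : Injective _≡_ _≡_ f
  f-injective {zero}           {zero}           _  = refl
  f-injective {zero}           {suc zero}       eq = contradiction eq x≢y
  f-injective {zero}           {suc (suc zero)} eq = contradiction eq x≢z
  f-injective {suc zero}       {zero}           eq = contradiction (sym eq) x≢y
  f-injective {suc zero}       {suc zero}       _  = refl
  f-injective {suc zero}       {suc (suc zero)} eq = contradiction eq y≢z
  f-injective {suc (suc zero)} {zero}           eq = contradiction (sym eq) x≢z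
  f-injective {suc (suc zero)} {suc zero}       eq = contradiction (sym eq) y≢z
  f-injective {suc (suc zero)} {suc (suc zero)} _  = refl

  f∈X : ∀ i → X (f i)
  f∈X zero             = Xx
  f∈X (suc zero)       = Xy
  f∈X (suc (suc zero)) = Xz

two-valued⇒¬AtLeast-3 : ∀ {A : Set} {X : Pred A _} {α β} →
                        (∀ {z} → X z → z ≡ α ⊎ z ≡ β) → ¬ AtLeast 3 X
two-valued⇒¬AtLeast-3 two (f , f-injective , f∈X)
  with two (f∈X zero) | two (f∈X (suc zero)) | two (f∈X (suc (suc zero)))
... | inj₁ p | inj₁ q | _      = contradiction (f-injective (trans p (sym q))) λ ()
... | inj₁ p | inj₂ _ | inj₁ r = contradiction (f-injective (trans p (sym r))) λ ()
... | inj₁ _ | inj₂ q | inj₂ r = contradiction (f-injective (trans q (sym r))) λ ()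
... | inj₂ p | inj₂ q | _      = contradiction (f-injective (trans p (sym q))) λ ()
... | inj₂ p | inj₁ _ | inj₂ r = contradiction (f-injective (trans p (sym r))) λ ()
... | inj₂ _ | inj₁ q | inj₁ r = contradiction (f-injective (trans q (sym r))) λ ()

-- A walk between two distinct vertices begins with an edge.
connected⇒edge : ∀ A → Connected A → 2 ≤ order A → ∃₂ λ a b → Adj A a b
connected⇒edge A connected 2≤ = first-step (connected (from (inject≤ zero 2≤)) (from (inject≤ (suc zero) 2≤)))
  λ eq → contradiction
    (Fin.inject≤-injective 2≤ 2≤ _ _ (Injection.injective (↔⇒↣ (↔-sym (V↔Fin A))) eq)) λ ()
  where
  open Inverse (V↔Fin A)
  first-step : ∀ {x y} → Star (Adj A) x y → x ≢ y → ∃₂ λ a b → Adj A a b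
  first-step done    x≢x = contradiction refl x≢x
  first-step (e ◅ _) _   = _ , _ , e

-- Integer congruences and weighted sums over a tuple

i≡-i⇒i≡0 : ∀ {i} → i ≡ ℤ.- i → i ≡ 0ℤ
i≡-i⇒i≡0 {+ zero}   _ = refl
i≡-i⇒i≡0 {+ suc _}  ()
i≡-i⇒i≡0 { -[1+ _ ]} ()

%ℕ-≡⇒∣- : ∀ {N} .{{_ : NonZero N}} x y → x ℤ.%ℕ N ≡ y ℤ.%ℕ N → + N ℤ.∣ x ℤ.- y
%ℕ-≡⇒∣- {N} x y eq = divides (x ℤ./ℕ N ℤ.- y ℤ./ℕ N) (begin
  x ℤ.- y                                                         ≡⟨ cong₂ ℤ._-_ (ℤ.a≡a%ℕn+[a/ℕn]*n x N) (ℤ.a≡a%ℕn+[a/ℕn]*n y N) ⟩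
  (+ (x ℤ.%ℕ N) ℤ.+ p ℤ.* + N) ℤ.- (+ (y ℤ.%ℕ N) ℤ.+ q ℤ.* + N)   ≡⟨ cong (λ r → (+ r ℤ.+ p ℤ.* + N) ℤ.- (+ (y ℤ.%ℕ N) ℤ.+ q ℤ.* + N)) eq ⟩
  (+ (y ℤ.%ℕ N) ℤ.+ p ℤ.* + N) ℤ.- (+ (y ℤ.%ℕ N) ℤ.+ q ℤ.* + N)   ≡⟨ cancel (+ (y ℤ.%ℕ N)) p q (+ N) ⟩
  (p ℤ.- q) ℤ.* + N                                               ∎)
  where
  open ≡-Reasoning
  p = x ℤ./ℕ N
  q = y ℤ./ℕ N
  cancel : ∀ r p q n → (r ℤ.+ p ℤ.* n) ℤ.- (r ℤ.+ q ℤ.* n) ≡ (p ℤ.- q) ℤ.* n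
  cancel = ℤ.solve-∀

tuple-ext : ∀ {d} (Gs : Vec Graph d) {v w : Tuple Gs} → (∀ i → v at i ≡ w at i) → v ≡ w
tuple-ext []       eq = refl
tuple-ext (G ∷ Gs) eq = cong₂ _,_ (eq zero) (tuple-ext Gs (eq ∘ suc))

weightedSum : ∀ {d} (Gs : Vec Graph d) → (∀ i → V (lookup Gs i) → ℤ) → (Fin d → ℕ) → Tuple Gs → ℤ
weightedSum []       c s _        = 0ℤ
weightedSum (G ∷ Gs) c s (v , vs) = c zero v ℤ.* + s zero ℤ.+ weightedSum Gs (λ i → c (suc i)) (s ∘ suc) vs

weightedSum-difference : ∀ {d} (Gs : Vec Graph d) c s {v w : Tuple Gs} i → (∀ j → j ≢ i → v at j ≡ w at j) →
  weightedSum Gs c s w ℤ.- weightedSum Gs c s v ≡ (c i (w at i) ℤ.- c i (v at i)) ℤ.* + s i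
weightedSum-difference (G ∷ Gs) c s {v , vs} {w , ws} zero eq
  rewrite tuple-ext Gs {vs} {ws} (λ j → eq (suc j) λ ()) = cancel (c zero w) (c zero v) (+ s zero) _
  where
  cancel : ∀ x y s r → (x ℤ.* s ℤ.+ r) ℤ.- (y ℤ.* s ℤ.+ r) ≡ (x ℤ.- y) ℤ.* s
  cancel = ℤ.solve-∀
weightedSum-difference (G ∷ Gs) c s {v , vs} {w , ws} (suc i) eq
  rewrite eq zero (λ ()) = trans (cancel (c zero w ℤ.* + s zero) _ _)
    (weightedSum-difference Gs (λ i → c (suc i)) (s ∘ suc) i λ j j≢i → eq (suc j) (j≢i ∘ Fin.suc-injective))
  where
  cancel : ∀ r x y → (r ℤ.+ x) ℤ.- (r ℤ.+ y) ≡ x ℤ.- y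
  cancel = ℤ.solve-∀

-- The k-multiplicative Sidon condition, with equality modulo N.
Separating : ∀ {d} → ℕ → ℕ → (Fin d → ℕ) → Set
Separating k N s = ∀ {i j a b} → a ≢ 0ℤ → b ≢ 0ℤ → ∣ a ∣ ≤ k → ∣ b ∣ ≤ k →
                   + N ℤ.∣ a ℤ.* + s i ℤ.- b ℤ.* + s j → i ≡ j × a ≡ b

-- The colouring of the product by a weighted sum modulo N

module ProductColouring
  {ℓ} {𝓕 : Pred Graph ℓ} (forb : IsForbiddenFamily 𝓕) {d : ℕ} (Gs : Vec Graph d)
  (c : ∀ i → V (lookup Gs i) → ℤ) {k : ℕ} (spread : ∀ i v w → ∣ c i v ℤ.- c i w ∣ ≤ k)
  (proper : ∀ i → IsColouring (lookup Gs i) (c i)) (free : ∀ i → IsFree 𝓕 (lookup Gs i) (c i))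
  {N : ℕ} .{{_ : NonZero N}} {s : Fin d → ℕ} (sep : Separating k N s) where

  private
    G = □ Gs
    sum = weightedSum Gs c s

  colour : V G → ℤ
  colour v = + (sum v ℤ.%ℕ N)

  private
    step : ∀ {v w} → Adj G v w → ℤ
    step {v} {w} (i , _) = c i (w at i) ℤ.- c i (v at i)

    step≢0 : ∀ {v w} (e : Adj G v w) → step {v} {w} e ≢ 0ℤ
    step≢0 (i , a , _) eq = proper i a (sym (ℤ.i-j≡0⇒i≡j _ _ eq))

    -- Along an edge `sum` changes by the step times the weight of the direction. If the end colours
    -- agree, two such changes are congruent modulo `N`, and `sep` recovers direction and step;
    -- `spread` keeps the steps within its range.
    rigid : ∀ {v w v′ w′} (e : Adj G v w) (e′ : Adj G v′ w′) →
            colour v ≡ colour v′ → colour w ≡ colour w′ →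
            proj₁ e ≡ proj₁ e′ × step {v} {w} e ≡ step {v′} {w′} e′
    rigid {v} {w} {v′} {w′} e@(i , _ , eq) e′@(i′ , _ , eq′) cv cw =
      sep (step≢0 {v} {w} e) (step≢0 {v′} {w′} e′) (spread _ _ _) (spread _ _ _)
        (subst (+ N ℤ.∣_) difference
          (ℤ.∣m∣n⇒∣m-n (%ℕ-≡⇒∣- (sum w) (sum w′) (ℤ.+-injective cw))
                       (%ℕ-≡⇒∣- (sum v) (sum v′) (ℤ.+-injective cv))))
      where
      exchange : ∀ w w′ v v′ → (w ℤ.- w′) ℤ.- (v ℤ.- v′) ≡ (w ℤ.- v) ℤ.- (w′ ℤ.- v′)
      exchange = ℤ.solve-∀
      difference : (sum w ℤ.- sum w′) ℤ.- (sum v ℤ.- sum v′) ≡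
                   step {v} {w} e ℤ.* + s i ℤ.- step {v′} {w′} e′ ℤ.* + s i′
      difference = trans (exchange (sum w) (sum w′) (sum v) (sum v′))
        (cong₂ ℤ._-_ (weightedSum-difference Gs c s {v} {w} i eq)
                     (weightedSum-difference Gs c s {v′} {w′} i′ eq′))

  -- If the ends had equal colours, `rigid` would apply to the edge and its own reversal: the step
  -- would equal its negative and vanish, although the factor colouring is proper.
  colour-isColouring : IsColouring G colour
  colour-isColouring {v} {w} e@(i , a , eq) same =
    step≢0 {v} {w} e (i≡-i⇒i≡0 (trans (proj₂ (rigid {v} {w} {w} {v} e (Graph.symm G {v} {w} e) same (sym same)))
                                      (reverse (c i (w at i)) (c i (v at i)))))
    where
    reverse : ∀ x y → y ℤ.- x ≡ ℤ.- (x ℤ.- y)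
    reverse = ℤ.solve-∀

  colour-AtMost : AtMost N (Colours colour U)
  colour-AtMost = +_ ∘ toℕ , λ { (v , _ , refl) → fromℕ< (ℤ.n%ℕd<d (sum v) N) , cong +_ (Fin.toℕ-fromℕ< _) }

  colour-isFree : IsFree 𝓕 G colour
  colour-isFree H A A∈𝓕 iso
    with connected , _ , 3≤ ← forb A∈𝓕
    with a₀ , b₀ , e₀ ← connected⇒edge A connected (ℕ.≤-trans (ℕ.n≤1+n 2) 3≤) = result
    where
    open Subgraph H
    open _≅_ iso

    edge : ∀ {x y} → Adj A x y → Adj G (to x) (to y)
    edge = Adjᴴ⇒Adj ∘ Equivalence.to adjacency

    f : V A → ℤ
    f = colour ∘ to

    i₀ = proj₁ (edge e₀)
    Gᵢ = lookup Gs i₀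

    p : V A → V Gᵢ
    p x = to x at i₀

    g : V A → ℤ
    g = c i₀ ∘ p

    f-proper : ∀ {x y} → Adj A x y → f x ≢ f y
    f-proper {x} {y} e = colour-isColouring {to x} {to y} (edge e)

    New : Pred (V A) _
    New x = f x ≢ f a₀ × f x ≢ f b₀

    new? : ∀ x → Dec (New x)
    new? x = ¬? (f x ℤ.≟ f a₀) ×-dec ¬? (f x ℤ.≟ f b₀)

    Fibre : V A → V A → Set
    Fibre x z = f x ≡ f z × g x ≡ g z

    module Bichromatic (none : ∀ x → ¬ New x) where
      -- The invariant carried along walks from `a₀`: the vertex stays in the copy of `Gᵢ` through
      -- `to a₀`, and its pair of product colour and factor colour is that of `a₀` or of `b₀`.
      Inv : V A → Set
      Inv x = (∀ j → j ≢ i₀ → to x at j ≡ to a₀ at j) × (Fibre x a₀ ⊎ Fibre x b₀)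

      other : ∀ {x} → f x ≢ f a₀ → f x ≡ f b₀
      other {x} ≢a = decidable-stable (f x ℤ.≟ f b₀) λ ≢b → none x (≢a , ≢b)

      other′ : ∀ {x} → f x ≢ f b₀ → f x ≡ f a₀
      other′ {x} ≢b = decidable-stable (f x ℤ.≟ f a₀) λ ≢a → none x (≢a , ≢b)

      cancel : ∀ {x y z} w → z ℤ.- x ≡ w ℤ.- y → x ≡ y → z ≡ w
      cancel {x} {_} {z} w eq refl = ∙-cancelʳ (AbelianGroup.group ℤ.+-0-abelianGroup) (ℤ.- x) z w eq

      -- The edge to `y` carries the two colours of the base edge, so `rigid` gives it the same
      -- direction and the same step; starting from `g a₀`, this step ends at `g b₀`.
      propagate : ∀ {x y} → Adj A x y → Inv x → Inv y
      propagate {x} {y} e (agree , inj₁ (fx , gx))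
        with fy ← other (λ fy → f-proper e (trans fx (sym fy)))
        with edge e | rigid {to x} {to y} {to a₀} {to b₀} (edge e) (edge e₀) fx fy
      ... | _ , _ , eq | refl , st =
        (λ j j≢i → trans (sym (eq j j≢i)) (agree j j≢i)) , inj₂ (fy , cancel (g b₀) st gx)
      -- From the side of `b₀` the comparison is with the reversed base edge.
      propagate {x} {y} e (agree , inj₂ (fx , gx))
        with fy ← other′ (λ fy → f-proper e (trans fx (sym fy)))
        with edge e | rigid {to x} {to y} {to b₀} {to a₀} (edge e) (Graph.symm G {to a₀} {to b₀} (edge e₀)) fx fy
      ... | _ , _ , eq | refl , st =
        (λ j j≢i → trans (sym (eq j j≢i)) (agree j j≢i)) , inj₁ (fy , cancel (g a₀) st gx)

      propagate* : ∀ {x y} → Star (Adj A) x y → Inv x → Inv y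
      propagate* done     = λ inv → inv
      propagate* (e ◅ es) = propagate* es ∘ propagate e

      inv : ∀ x → Inv x
      inv x = propagate* (connected a₀ x) ((λ _ _ → refl) , inj₁ (refl , refl))

      p-injective : Injective _≡_ _≡_ p
      p-injective {x} {y} eq = injective (tuple-ext Gs λ j → at-≡ j)
        where
        at-≡ : ∀ j → to x at j ≡ to y at j
        at-≡ j with j Fin.≟ i₀
        ... | yes refl = eq
        ... | no  j≢i  = trans (proj₁ (inv x) j j≢i) (sym (proj₁ (inv y) j j≢i))

      p-edge : ∀ {x y} → Adj A x y → Adj Gᵢ (p x) (p y)
      p-edge {x} {y} e with edge e
      ... | j , a , _ with j Fin.≟ i₀
      ...   | yes refl = a
      ...   | no  j≢i  = contradiction a
        (Graph.irrefl (lookup Gs j) (trans (proj₁ (inv x) j j≢i) (sym (proj₁ (inv y) j j≢i))))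

      -- Only images of edges of `A` are kept, rather than all edges induced in `Gᵢ`, so that
      -- adjacency is reflected.
      projection : Subgraph Gᵢ
      projection = record
        { Vᴴ        = λ v → ∃ λ x → p x ≡ v
        ; Adjᴴ      = λ v w → ∃₂ λ x y → Adj A x y × p x ≡ v × p y ≡ w
        ; symᴴ      = λ (x , y , e , px , py) → y , x , Graph.symm A e , py , px
        ; endpoints = λ (x , y , e , px , py) → (x , px) , (y , py)
        ; Adjᴴ⇒Adj  = λ { (x , y , e , refl , refl) → p-edge e }
        }

      projection-≅ : A ≅ projection
      projection-≅ = record
        { to         = p
        ; injective  = p-injective
        ; to∈        = λ a → a , refl
        ; surjective = λ v∈ → v∈
        ; adjacency  = mk⇔ (λ e → _ , _ , e , refl , refl)
            λ (x , y , e , px , py) → subst₂ (Adj A) (p-injective px) (p-injective py) e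
        }

      absurd : ∀ {a} {X : Set a} → X
      absurd = contradiction (free i₀ projection A A∈𝓕 projection-≅)
        (two-valued⇒¬AtLeast-3 {α = g a₀} {β = g b₀} two)
        where
        two : ∀ {z} → Colours (c i₀) (Subgraph.Vᴴ projection) z → z ≡ g a₀ ⊎ z ≡ g b₀
        two (_ , (x , refl) , refl) with proj₂ (inv x)
        ... | inj₁ (_ , eq) = inj₁ eq
        ... | inj₂ (_ , eq) = inj₂ eq

    result : AtLeast 3 (Colours colour Vᴴ)
    -- `V A` is finite, so the search for a third colour besides `f a₀` and `f b₀` is decidable.
    result with Fin.any? (new? ∘ Inverse.from (V↔Fin A))
    ... | yes (n , ≢a , ≢b) = three-values {X = Colours colour Vᴴ} (f-proper e₀) (≢a ∘ sym) (≢b ∘ sym)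
          (to a₀ , to∈ a₀ , refl) (to b₀ , to∈ b₀ , refl) (to _ , to∈ _ , refl)
    ... | no none = Bichromatic.absurd λ x new → none (Inverse.to (V↔Fin A) x ,
          subst New (sym (Inverse.strictlyInverseʳ (V↔Fin A) x)) new)

  hasFreeColouring-□ : HasFreeColouring 𝓕 G N
  hasFreeColouring-□ = colour , (λ {v} {w} → colour-isColouring {v} {w}) , colour-AtMost , colour-isFree

-- Normalising the factor colourings and reduction to separating families

∣+m-+n∣≤ : ∀ {k} m n → m ≤ k → n ≤ k → ∣ + m ℤ.- + n ∣ ≤ k
∣+m-+n∣≤ m n m≤k n≤k = subst (_≤ _) (cong ∣_∣ (sym (ℤ.[+m]-[+n]≡m⊖n m n)))
  (ℕ.≤-trans (ℤ.∣m⊝n∣≤m⊔n m n) (ℕ.⊔-lub m≤k n≤k))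

module _ {ℓ} {𝓕 : Pred Graph ℓ} {G : Graph} {n : ℕ} (coloured : HasFreeColouring 𝓕 G n) where
  private
    c      = proj₁ coloured
    proper = proj₁ (proj₂ coloured)
    few    = proj₁ (proj₂ (proj₂ coloured))
    atMost = proj₂ (proj₁ (proj₂ (proj₂ coloured)))
    free   = proj₂ (proj₂ (proj₂ coloured))

    index : V G → Fin n
    index v = proj₁ (atMost (v , tt , refl))

    index-≡⇒c-≡ : ∀ {v w} → index v ≡ index w → c v ≡ c w
    index-≡⇒c-≡ {v} {w} eq = begin
      c v             ≡⟨ proj₂ (atMost (v , tt , refl)) ⟨
      proj₁ few (index v) ≡⟨ cong (proj₁ few) eq ⟩
      proj₁ few (index w) ≡⟨ proj₂ (atMost (w , tt , refl)) ⟩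
      c w             ∎
      where open ≡-Reasoning

  -- The given colours may be far apart as integers; their indices among `n` values are not. Equal
  -- indices come from equal colours, so classes may split but never merge, which preserves
  -- properness and freeness.
  renamed : V G → ℤ
  renamed v = + toℕ (index v)

  private
    renamed-≡⇒c-≡ : ∀ {v w} → renamed v ≡ renamed w → c v ≡ c w
    renamed-≡⇒c-≡ = index-≡⇒c-≡ ∘ Fin.toℕ-injective ∘ ℤ.+-injective

  renamed-spread : ∀ {k} → n ≤ k + 1 → ∀ v w → ∣ renamed v ℤ.- renamed w ∣ ≤ k
  renamed-spread {k} n≤ v w = ∣+m-+n∣≤ _ _ (bound (index v)) (bound (index w))
    where
    bound : (i : Fin n) → toℕ i ≤ k
    bound i = ℕ.≤-pred (ℕ.≤-trans (Fin.toℕ<n i) (subst (n ≤_) (ℕ.+-comm k 1) n≤))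

  renamed-isColouring : IsColouring G renamed
  renamed-isColouring e eq = proper e (renamed-≡⇒c-≡ eq)

  renamed-isFree : IsFree 𝓕 G renamed
  renamed-isFree H A A∈𝓕 iso with free H A A∈𝓕 iso
  ... | f , f-injective , f∈ = (λ i → renamed (proj₁ (f∈ i)))
    , (λ {i} {j} eq → f-injective (trans (sym (proj₂ (proj₂ (f∈ i)))) (trans (renamed-≡⇒c-≡ eq) (proj₂ (proj₂ (f∈ j))))))
    , λ i → proj₁ (f∈ i) , proj₁ (proj₂ (f∈ i)) , refl

-- Reduces each upper bound to finding a separating family of `d` weights with a small modulus.
χ-□≤ : ∀ {ℓ} {𝓕 : Pred Graph ℓ} → IsForbiddenFamily 𝓕 →
       ∀ {k d N} .{{_ : NonZero N}} {s : Fin d → ℕ} → Separating k N s →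
       ∀ (Gs : Vec Graph d) (χs : Fin d → ℕ) →
       (∀ i → IsFreeChromaticNumber 𝓕 (lookup Gs i) (χs i)) → (∀ i → χs i ≤ k + 1) →
       ∀ {χ} → IsFreeChromaticNumber 𝓕 (□ Gs) χ → χ ≤ N
χ-□≤ forb sep Gs χs isχs χs≤ (_ , minimal) = minimal _ hasFreeColouring-□
  where
  open ProductColouring forb Gs (λ i → renamed (proj₁ (isχs i)))
    (λ i → renamed-spread (proj₁ (isχs i)) (χs≤ i))
    (λ i → renamed-isColouring (proj₁ (isχs i)))
    (λ i → renamed-isFree (proj₁ (isχs i))) sep

-- The arithmetic progression behind the first bound

pred-< : ∀ {m} → 1 ≤ m → pred m < m
pred-< {suc m} _ = ℕ.≤-refl

∣∧<⇒≡0 : ∀ {N z} → + N ℤ.∣ z → ∣ z ∣ < N → z ≡ 0ℤ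
∣∧<⇒≡0 {N} {z} N∣z z<N with ∣ z ∣ in eq
... | zero  = ℤ.∣i∣≡0⇒i≡0 eq
... | suc n = contradiction (subst (N ℕ.∣_) eq (ℤ.∣⇒∣ᵤ N∣z)) (ℕ.>⇒∤ z<N)

≡-mod⇒≡ : ∀ {k x y} → 1 ≤ x → x ≤ k → 1 ≤ y → y ≤ k → + k ℤ.∣ + x ℤ.- + y → x ≡ y
≡-mod⇒≡ {k} {suc x} {suc y} _ x≤k _ y≤k k∣ = ℤ.+-injective (ℤ.i-j≡0⇒i≡j _ _ (∣∧<⇒≡0 k∣ (begin-strict
  ∣ + suc x ℤ.- + suc y ∣  ≡⟨ cong ∣_∣ (cancel (+ x) (+ y)) ⟩
  ∣ + x ℤ.- + y ∣          ≤⟨ ∣+m-+n∣≤ x y (ℕ.pred-mono-≤ x≤k) (ℕ.pred-mono-≤ y≤k) ⟩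
  pred k                 <⟨ pred-< (ℕ.≤-trans (s≤s z≤n) x≤k) ⟩
  k                        ∎)))
  where
  open ℕ.≤-Reasoning
  cancel : ∀ x y → (+ 1 ℤ.+ x) ℤ.- (+ 1 ℤ.+ y) ≡ x ℤ.- y
  cancel = ℤ.solve-∀

≢0⇒1≤∣∣ : ∀ {a} → a ≢ 0ℤ → 1 ≤ ∣ a ∣
≢0⇒1≤∣∣ a≢0 = ℕ.n≢0⇒n>0 (a≢0 ∘ ℤ.∣i∣≡0⇒i≡0)

-- x (k i + 1) = y (k j + 1) forces x ≡ y modulo k, hence x = y.
progression-separating : ∀ {k d} → 1 ≤ k → 1 ≤ d →
  Separating {d} k (2 * k * (k * d ∸ k + 1) + 1) (λ i → k * toℕ i + 1)
progression-separating {k} {d} 1≤k 1≤d {i} {j} {a} {b} a≢0 b≢0 a≤k b≤k N∣ = i≡j , a≡b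
  where
  M = k * d ∸ k + 1
  s : Fin d → ℕ
  s i = k * toℕ i + 1

  s≤M : ∀ i → s i ≤ M
  s≤M i = ℕ.+-monoˡ-≤ 1 (begin
    k * toℕ i      ≤⟨ ℕ.*-monoʳ-≤ k (Fin.toℕ≤pred[n] i) ⟩
    k * pred d     ≡⟨ cong (k *_) (sym (ℕ.pred[m∸n]≡m∸[1+n] d 0)) ⟩
    k * (d ∸ 1)    ≡⟨ ℕ.*-distribˡ-∸ k d 1 ⟩
    k * d ∸ k * 1  ≡⟨ cong (k * d ∸_) (ℕ.*-identityʳ k) ⟩
    k * d ∸ k      ∎)
    where open ℕ.≤-Reasoning

  -- Each product is at most `k * M` in absolute value, so the modulus exceeds every possible
  -- difference and the congruence becomes an equality.
  small : ∣ a ℤ.* + s i ℤ.- b ℤ.* + s j ∣ < 2 * k * M + 1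
  small = begin-strict
    ∣ a ℤ.* + s i ℤ.- b ℤ.* + s j ∣          ≤⟨ ℤ.∣i-j∣≤∣i∣+∣j∣ (a ℤ.* + s i) (b ℤ.* + s j) ⟩
    ∣ a ℤ.* + s i ∣ + ∣ b ℤ.* + s j ∣        ≡⟨ cong₂ _+_ (ℤ.abs-* a (+ s i)) (ℤ.abs-* b (+ s j)) ⟩
    ∣ a ∣ * s i + ∣ b ∣ * s j                ≤⟨ ℕ.+-mono-≤ (ℕ.*-mono-≤ a≤k (s≤M i)) (ℕ.*-mono-≤ b≤k (s≤M j)) ⟩
    k * M + k * M                            ≡⟨ double k M ⟩
    2 * k * M                                <⟨ ℕ.≤-reflexive (ℕ.+-comm 1 (2 * k * M)) ⟩
    2 * k * M + 1                            ∎
    where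
    open ℕ.≤-Reasoning
    double : ∀ k M → k * M + k * M ≡ 2 * k * M
    double = ℕ.solve-∀

  as≡bs : a ℤ.* + s i ≡ b ℤ.* + s j
  as≡bs = ℤ.i-j≡0⇒i≡j _ _ (∣∧<⇒≡0 N∣ small)

  ∣a∣s≡∣b∣s : ∣ a ∣ * s i ≡ ∣ b ∣ * s j
  ∣a∣s≡∣b∣s = trans (sym (ℤ.abs-* a (+ s i))) (trans (cong ∣_∣ as≡bs) (ℤ.abs-* b (+ s j)))

  -- Both weights are 1 modulo `k`, so equal products have congruent multipliers.
  k∣ : + k ℤ.∣ + ∣ a ∣ ℤ.- + ∣ b ∣
  k∣ = divides (y ℤ.* + toℕ j ℤ.- x ℤ.* + toℕ i) (begin
    x ℤ.- y                                            ≡⟨ expand x y (+ k) (+ toℕ i) (+ toℕ j) ⟩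
    X i x ℤ.- X j y ℤ.+ (y ℤ.* + toℕ j ℤ.- x ℤ.* + toℕ i) ℤ.* + k
      ≡⟨ cong (λ z → z ℤ.+ (y ℤ.* + toℕ j ℤ.- x ℤ.* + toℕ i) ℤ.* + k) (ℤ.i≡j⇒i-j≡0 X≡X) ⟩
    0ℤ ℤ.+ (y ℤ.* + toℕ j ℤ.- x ℤ.* + toℕ i) ℤ.* + k   ≡⟨ ℤ.+-identityˡ _ ⟩
    (y ℤ.* + toℕ j ℤ.- x ℤ.* + toℕ i) ℤ.* + k          ∎)
    where
    open ≡-Reasoning
    x = + ∣ a ∣
    y = + ∣ b ∣
    X : Fin d → ℤ → ℤ
    X i x = x ℤ.* (+ k ℤ.* + toℕ i ℤ.+ + 1)
    X≡ : ∀ i n → X i (+ n) ≡ + (n * s i)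
    X≡ i n = trans (cong (λ z → + n ℤ.* (z ℤ.+ + 1)) (sym (ℤ.pos-* k (toℕ i)))) (sym (ℤ.pos-* n (s i)))
    X≡X : X i x ≡ X j y
    X≡X = trans (X≡ i ∣ a ∣) (trans (cong +_ ∣a∣s≡∣b∣s) (sym (X≡ j ∣ b ∣)))
    expand : ∀ x y k i j → x ℤ.- y ≡ x ℤ.* (k ℤ.* i ℤ.+ + 1) ℤ.- y ℤ.* (k ℤ.* j ℤ.+ + 1)
                                     ℤ.+ (y ℤ.* j ℤ.- x ℤ.* i) ℤ.* k
    expand = ℤ.solve-∀

  ∣a∣≡∣b∣ : ∣ a ∣ ≡ ∣ b ∣
  ∣a∣≡∣b∣ = ≡-mod⇒≡ (≢0⇒1≤∣∣ a≢0) a≤k (≢0⇒1≤∣∣ b≢0) b≤k k∣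

  i≡j : i ≡ j
  i≡j = Fin.toℕ-injective (ℕ.*-cancelˡ-≡ _ _ k {{ℕ.>-nonZero 1≤k}}
    (ℕ.+-cancelʳ-≡ 1 _ _ (ℕ.*-cancelˡ-≡ (s i) (s j) ∣ a ∣ {{ℕ.>-nonZero (≢0⇒1≤∣∣ a≢0)}}
      (trans ∣a∣s≡∣b∣s (cong (_* s j) (sym ∣a∣≡∣b∣))))))

  -- Cancelling the positive weight in the signed equation restores the signs lost in `∣a∣≡∣b∣`.
  a≡b : a ≡ b
  a≡b = ℤ.*-cancelʳ-≡ a b (+ s i) {{ℕ.>-nonZero (ℕ.m≤n+m 1 (k * toℕ i))}}
    (trans as≡bs (cong (λ i → b ℤ.* + s i) (sym i≡j)))

-- Lifting separating families to large moduli

separating-∘ : ∀ {k N d e} {s : Fin d → ℕ} {f : Fin e → Fin d} → Injective _≡_ _≡_ f →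
               Separating k N s → Separating k N (s ∘ f)
separating-∘ f-injective sep a≢0 b≢0 a≤k b≤k N∣ =
  let i≡j , a≡b = sep a≢0 b≢0 a≤k b≤k N∣ in f-injective i≡j , a≡b

module Lift {k q r : ℕ} .{{_ : NonZero q}} {t : Fin r → ℕ} (sep : Separating k q t)
            {m : ℕ} (coprime : ∀ {a} → 1 ≤ a → a ≤ k → Coprime m a) where

  -- An index is read as a pair: the quotient selects a residue modulo `q`, the remainder one of its
  -- `m` lifts modulo `q * m`.
  lift : Fin (r * m) → ℕ
  lift i = t (quotient m i) + q * toℕ (remainder {r} m i)

  +lift : ∀ i → + lift i ≡ + t (quotient m i) ℤ.+ + q ℤ.* + toℕ (remainder {r} m i)
  +lift i = cong (λ z → + t (quotient m i) ℤ.+ z) (ℤ.pos-* q (toℕ (remainder {r} m i)))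

  -- Modulo `q`, `sep` gives the same residue and `a ≡ b`. Dividing what remains by `q`, `m` divides
  -- `a` times the difference of the remainders; `a` is coprime to `m` and the difference is smaller
  -- than `m`.
  lift-separating : Separating k (q * m) lift
  lift-separating {i} {j} {a} {b} a≢0 b≢0 a≤k b≤k N∣ = i≡j , a≡b
    where
    u  = + t (quotient m i)
    u′ = + t (quotient m j)
    v  = + toℕ (remainder {r} m i)
    v′ = + toℕ (remainder {r} m j)

    qm∣ : + q ℤ.* + m ℤ.∣ a ℤ.* (u ℤ.+ + q ℤ.* v) ℤ.- b ℤ.* (u′ ℤ.+ + q ℤ.* v′)
    qm∣ = subst₂ ℤ._∣_ (ℤ.pos-* q m) (cong₂ (λ x y → a ℤ.* x ℤ.- b ℤ.* y) (+lift i) (+lift j)) N∣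

    q∣ : + q ℤ.∣ a ℤ.* u ℤ.- b ℤ.* u′
    q∣ = ℤ.∣m+n∣n⇒∣m
      (subst (+ q ℤ.∣_) (regroup a b u u′ (+ q) v v′) (ℤ.∣-trans (divides (+ m) (ℤ.*-comm (+ q) (+ m))) qm∣))
      (divides (a ℤ.* v ℤ.- b ℤ.* v′) refl)
      where
      regroup : ∀ a b u u′ q v v′ → a ℤ.* (u ℤ.+ q ℤ.* v) ℤ.- b ℤ.* (u′ ℤ.+ q ℤ.* v′) ≡
                                    (a ℤ.* u ℤ.- b ℤ.* u′) ℤ.+ (a ℤ.* v ℤ.- b ℤ.* v′) ℤ.* q
      regroup = ℤ.solve-∀

    quotient-≡ : quotient m i ≡ quotient m j
    quotient-≡ = proj₁ (sep a≢0 b≢0 a≤k b≤k q∣)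

    a≡b : a ≡ b
    a≡b = proj₂ (sep a≢0 b≢0 a≤k b≤k q∣)

    m∣ : + m ℤ.∣ a ℤ.* (v ℤ.- v′)
    m∣ = ℤ.*-cancelˡ-∣ (+ q) (subst (+ q ℤ.* + m ℤ.∣_)
      (trans (cong₂ (λ b u′ → a ℤ.* (u ℤ.+ + q ℤ.* v) ℤ.- b ℤ.* (u′ ℤ.+ + q ℤ.* v′))
                    (sym a≡b) (cong (+_ ∘ t) (sym quotient-≡)))
             (factor a u (+ q) v v′)) qm∣)
      where
      factor : ∀ a u q v v′ → a ℤ.* (u ℤ.+ q ℤ.* v) ℤ.- a ℤ.* (u ℤ.+ q ℤ.* v′) ≡ q ℤ.* (a ℤ.* (v ℤ.- v′))
      factor = ℤ.solve-∀

    remainder-≡ : remainder {r} m i ≡ remainder {r} m j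
    remainder-≡ = Fin.toℕ-injective (ℤ.+-injective (ℤ.i-j≡0⇒i≡j v v′ (∣∧<⇒≡0
      (ℤ.∣ᵤ⇒∣ (coprime-divisor (coprime (≢0⇒1≤∣∣ a≢0) a≤k)
        (subst (m ℕ.∣_) (ℤ.abs-* a (v ℤ.- v′)) (ℤ.∣⇒∣ᵤ m∣))))
      (ℕ.≤-<-trans
        (∣+m-+n∣≤ _ _ (Fin.toℕ≤pred[n] (remainder {r} m i)) (Fin.toℕ≤pred[n] (remainder {r} m j)))
        (pred-< (ℕ.≤-trans (s≤s z≤n) (Fin.toℕ<n (remainder {r} m i))))))))

    i≡j : i ≡ j
    i≡j = trans (sym (Fin.combine-remQuot {r} m i))
      (trans (cong₂ combine quotient-≡ remainder-≡) (Fin.combine-remQuot {r} m j))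

-- A common divisor divides `k !`, since `1 ≤ a ≤ k`, and hence also 1.
1+k!t-coprime : ∀ k t {a} → 1 ≤ a → a ≤ k → Coprime (suc (k ! * t)) a
1+k!t-coprime k t {suc a} _ a≤k {c} (c∣m , c∣a) = ℕ.∣1⇒≡1 (ℕ.∣m+n∣m⇒∣n {m = k ! * t}
  (subst (c ℕ.∣_) (ℕ.+-comm 1 (k ! * t)) c∣m)
  (ℕ.∣m⇒∣m*n t (ℕ.∣-trans c∣a (ℕ.∣-trans (ℕ.m∣m*n (a !)) (ℕ.m≤n⇒m!∣n! a≤k)))))

-- Take m ≡ 1 modulo k!, which is coprime to 1, …, k, just large enough that d ≤ r m.
dense-separating : ∀ {k q r} .{{_ : NonZero q}} .{{_ : NonZero r}} {t : Fin r → ℕ} → Separating k q t →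
  ∀ d → ∃ λ N → NonZero N × N * r ≤ q * (d + r * suc (k !)) × ∃ λ (s : Fin d → ℕ) → Separating k N s
dense-separating {k} {q} {r} {t} sep d =
  q * m , ℕ.m*n≢0 q m , bound , lift ∘ (λ i → inject≤ i d≤rm) ,
  separating-∘ {k} {q * m} {s = lift} (λ eq → Fin.inject≤-injective d≤rm d≤rm _ _ eq) lift-separating
  where
  P = r * k !
  instance
    k!≢0 : NonZero (k !)
    k!≢0 = k ℕ.!≢0
    P≢0 : NonZero P
    P≢0 = ℕ.m*n≢0 r (k !)
  -- One more than the quotient, so that `u * P` reaches `d` whatever the remainder. The overshoot
  -- of at most `P`, and `r` from the 1 in `m`, give `r * m ≤ d + r * suc (k !)`.
  u = suc (d ℕ./ P)
  m = suc (k ! * u)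
  open Lift {k} {q} {r} {t} sep {m} (1+k!t-coprime k u)
  open ℕ.≤-Reasoning

  rm≡ : r * m ≡ r + u * P
  rm≡ = arith r (k !) u
    where
    arith : ∀ r f u → r * suc (f * u) ≡ r + u * (r * f)
    arith = ℕ.solve-∀

  d≤rm : d ≤ r * m
  d≤rm = begin
    d                    ≡⟨ ℕ.m≡m%n+[m/n]*n d P ⟩
    d ℕ.% P + d ℕ./ P * P    ≤⟨ ℕ.+-monoˡ-≤ (d ℕ./ P * P) (ℕ.m%n≤n d P) ⟩
    u * P                ≤⟨ ℕ.m≤n+m (u * P) r ⟩
    r + u * P            ≡⟨ sym rm≡ ⟩
    r * m                ∎

  bound : q * m * r ≤ q * (d + r * suc (k !))
  bound = begin
    q * m * r                     ≡⟨ trans (ℕ.*-assoc q m r) (cong (q *_) (ℕ.*-comm m r)) ⟩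
    q * (r * m)                   ≡⟨ cong (q *_) rm≡ ⟩
    q * (r + (P + d ℕ./ P * P))     ≤⟨ ℕ.*-monoʳ-≤ q (ℕ.+-monoʳ-≤ r (ℕ.+-monoʳ-≤ P (ℕ.m/n*n≤m d P))) ⟩
    q * (r + (P + d))             ≡⟨ cong (q *_) (arith r (k !) d) ⟩
    q * (d + r * suc (k !))       ∎
    where
    arith : ∀ r f d → r + (r * f + d) ≡ d + r * suc f
    arith = ℕ.solve-∀

-- Base families of one weight, and of three weights for k = 2

-- Multipliers between -k and k differ by at most 2k, less than the modulus.
singleton-separating : ∀ k → Separating {1} k (2 * k + 1) (λ _ → 1)
singleton-separating k {zero} {zero} {a} {b} _ _ a≤k b≤k N∣ = refl , ℤ.i-j≡0⇒i≡j a b (∣∧<⇒≡0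
  (subst (+ (2 * k + 1) ℤ.∣_) (cong₂ ℤ._-_ (ℤ.*-identityʳ a) (ℤ.*-identityʳ b)) N∣) (begin-strict
    ∣ a ℤ.- b ∣    ≤⟨ ℤ.∣i-j∣≤∣i∣+∣j∣ a b ⟩
    ∣ a ∣ + ∣ b ∣  ≤⟨ ℕ.+-mono-≤ a≤k b≤k ⟩
    k + k          <⟨ ℕ.≤-reflexive (arith k) ⟩
    2 * k + 1      ∎))
  where
  open ℕ.≤-Reasoning
  arith : ∀ k → suc (k + k) ≡ 2 * k + 1
  arith = ℕ.solve-∀

-- The products of ±1, ±2 with 1, 3, 4 are the twelve nonzero residues modulo 13. The cost 13/3 per
-- weight improves on the 5 of a single weight, which exceeds 4 e^γ log 2 ≈ 4.94.
module Splitting-13 where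
  multiplier : Fin 4 → ℤ
  multiplier = lookup (-[1+ 1 ] ∷ -[1+ 0 ] ∷ + 1 ∷ + 2 ∷ [])

  multiplier-surjective : ∀ {a} → a ≢ 0ℤ → ∣ a ∣ ≤ 2 → ∃ λ x → multiplier x ≡ a
  multiplier-surjective {+ 0}      a≢0 _ = contradiction refl a≢0
  multiplier-surjective {+ 1}      _   _ = suc (suc zero) , refl
  multiplier-surjective {+ 2}      _   _ = suc (suc (suc zero)) , refl
  multiplier-surjective { -[1+ 0 ]} _  _ = suc zero , refl
  multiplier-surjective { -[1+ 1 ]} _  _ = zero , refl
  multiplier-surjective {+ suc (suc (suc _))}  _ (s≤s (s≤s ()))
  multiplier-surjective { -[1+ suc (suc _) ]} _ (s≤s (s≤s ()))

  base : Fin 3 → ℕ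
  base = lookup (1 ∷ 3 ∷ 4 ∷ [])

  products-distinct : ∀ i j x y →
    + 13 ℤ.∣ multiplier x ℤ.* + base i ℤ.- multiplier y ℤ.* + base j → i ≡ j × x ≡ y
  -- Evaluation of 3 · 3 · 4 · 4 = 144 cases.
  products-distinct = from-yes (Fin.all? λ i → Fin.all? λ j → Fin.all? λ x → Fin.all? λ y →
    (+ 13 ℤ.∣? (multiplier x ℤ.* + base i ℤ.- multiplier y ℤ.* + base j)) →-dec (i Fin.≟ j) ×-dec (x Fin.≟ y))

  base-separating : Separating 2 13 base
  base-separating a≢0 b≢0 a≤2 b≤2 13∣
    with x , refl ← multiplier-surjective a≢0 a≤2
    with y , refl ← multiplier-surjective b≢0 b≤2 =
    let i≡j , x≡y = products-distinct _ _ x y 13∣ in i≡j , cong multiplier x≡y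

-- Rational lower bounds for real numbers

p≤∣p∣ : ∀ p → p ℚ.≤ ℚ.∣ p ∣
p≤∣p∣ (mkℚ (+ _) _ _)        = ℚ.≤-refl
p≤∣p∣ p@(mkℚ -[1+ _ ] _ _) = ℚ.≤-trans (ℚ.<⇒≤ (ℚ.negative⁻¹ p)) (ℚ.0≤∣p∣ p)

0≤* : ∀ {p q} → 0ℚ ℚ.≤ p → 0ℚ ℚ.≤ q → 0ℚ ℚ.≤ p ℚ.* q
0≤* {p} {q} 0≤p 0≤q = subst (ℚ._≤ p ℚ.* q) (ℚ.*-zeroˡ 0ℚ) (*-mono 0≤p ℚ.≤-refl 0≤p 0≤q)

/-+ : ∀ a b m → + a / suc m ℚ.+ + b / suc m ≡ + (a + b) / suc m
/-+ a zero    m = trans (cong (+ a / suc m ℚ.+_) (ℚ.0/n≡0 (suc m)))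
  (trans (ℚ.+-identityʳ (+ a / suc m)) (cong (λ c → + c / suc m) (sym (ℕ.+-identityʳ a))))
/-+ a (suc b) m = begin
  + a / suc m ℚ.+ + suc b / suc m                    ≡⟨ cong (+ a / suc m ℚ.+_) (/-suc b m) ⟨
  + a / suc m ℚ.+ (+ b / suc m ℚ.+ + 1 / suc m)      ≡⟨ ℚ.+-assoc (+ a / suc m) (+ b / suc m) (+ 1 / suc m) ⟨
  (+ a / suc m ℚ.+ + b / suc m) ℚ.+ + 1 / suc m      ≡⟨ cong (ℚ._+ + 1 / suc m) (/-+ a b m) ⟩
  + (a + b) / suc m ℚ.+ + 1 / suc m                  ≡⟨ /-suc (a + b) m ⟩
  + suc (a + b) / suc m                              ≡⟨ cong (λ c → + c / suc m) (ℕ.+-suc a b) ⟨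
  + (a + suc b) / suc m                              ∎
  where open ≡-Reasoning

/1-* : ∀ m n → + (m * n) / 1 ≡ (+ m / 1) ℚ.* (+ n / 1)
/1-* zero    n = trans (ℚ.0/n≡0 1) (sym (ℚ.*-zeroˡ (+ n / 1)))
/1-* (suc m) n = begin
  + (n + m * n) / 1                             ≡⟨ /-+ n (m * n) 0 ⟨
  + n / 1 ℚ.+ + (m * n) / 1                     ≡⟨ cong (+ n / 1 ℚ.+_) (/1-* m n) ⟩
  + n / 1 ℚ.+ (+ m / 1) ℚ.* (+ n / 1)           ≡⟨ solve 2 (λ m n → n :+ m :* n := (m :+ con 1ℚ) :* n) refl (+ m / 1) (+ n / 1) ⟩
  (+ m / 1 ℚ.+ 1ℚ) ℚ.* (+ n / 1)                ≡⟨ cong (ℚ._* (+ n / 1)) (/-suc m 0) ⟩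
  (+ suc m / 1) ℚ.* (+ n / 1)                   ∎
  where open ≡-Reasoning

infix 4 _≲_
-- Stronger than `fromℚ q ≤ᴿ x`: the approximations eventually exceed `q` without an error ε, so
-- these bounds add and multiply without error terms.
_≲_ : ℚ → ℝ → Set
q ≲ x = ∃ λ N → ∀ n → N ≤ n → q ℚ.≤ approx x n

≲-≤ : ∀ {p q x} → p ℚ.≤ q → q ≲ x → p ≲ x
≲-≤ p≤q (N , h) = N , λ n N≤n → ℚ.≤-trans p≤q (h n N≤n)

fromℚ-≲ : ∀ q → q ≲ fromℚ q
fromℚ-≲ q = 0 , λ _ _ → ℚ.≤-refl

+-≲ : ∀ {p q x y} → p ≲ x → q ≲ y → p ℚ.+ q ≲ x +ᴿ y
+-≲ (M , h) (N , g) = M ⊔ N , λ n ≤n →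
  ℚ.+-mono-≤ (h n (ℕ.m⊔n≤o⇒m≤o M N ≤n)) (g n (ℕ.m⊔n≤o⇒n≤o M N ≤n))

*-≲ : ∀ {p q x y} → 0ℚ ℚ.≤ p → 0ℚ ℚ.≤ q → p ≲ x → q ≲ y → p ℚ.* q ≲ x *ᴿ y
*-≲ 0≤p 0≤q (M , h) (N , g) = M ⊔ N , λ n ≤n →
  let p≤x = h n (ℕ.m⊔n≤o⇒m≤o M N ≤n) in
  *-mono (ℚ.≤-trans 0≤p p≤x) 0≤q p≤x (g n (ℕ.m⊔n≤o⇒n≤o M N ≤n))

≲⇒fromℚ-≤ᴿ : ∀ {q x} → q ≲ x → fromℚ q ≤ᴿ x
≲⇒fromℚ-≤ᴿ {q} {x} (N , h) ε = N , λ n N≤n → begin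
  q                  ≤⟨ h n N≤n ⟩
  approx x n         ≡⟨ ℚ.+-identityʳ (approx x n) ⟨
  approx x n ℚ.+ 0ℚ  ≤⟨ ℚ.+-monoʳ-≤ (approx x n) (ℚ.<⇒≤ (ℚ.positive⁻¹ ε)) ⟩
  approx x n ℚ.+ ε   ∎
  where open ℚ.≤-Reasoning

-- The n-th approximation of the limit is that of `x n` at its modulus, which can lie up to 1/(n+1)
-- below the later ones known to be at least `q`; the loss `ε` covers this gap.
lim-≲ : ∀ {x q} (x-cauchy : Cauchyᴿ x) n₀ → (∀ n → n₀ ≤ n → q ≲ x n) →
        ∀ ε .{{_ : Positive ε}} → q ℚ.- ε ≲ lim x x-cauchy
lim-≲ {x} {q} x-cauchy n₀ q≲x ε = n₀ ⊔ N , λ n ≤n →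
  let I , q≤ = q≲x n (ℕ.m⊔n≤o⇒m≤o n₀ N ≤n)
      M , near = cauchy (x n) (+ 1 / suc n) {{/-pos {n}}}
      y = approx (x n) M
      z = approx (x n) (I ⊔ M)
  in begin
  q ℚ.- ε              ≤⟨ ℚ.+-monoˡ-≤ (ℚ.- ε) (q≤ (I ⊔ M) (ℕ.m≤m⊔n I M)) ⟩
  z ℚ.- ε              ≡⟨ solve 3 (λ y z ε → z :- ε := (z :- y) :+ (y :- ε)) refl y z ε ⟩
  (z ℚ.- y) ℚ.+ (y ℚ.- ε)  ≤⟨ ℚ.+-monoˡ-≤ (y ℚ.- ε) (begin
    z ℚ.- y                ≤⟨ p≤∣p∣ (z ℚ.- y) ⟩
    ℚ.∣ z ℚ.- y ∣          ≤⟨ near (I ⊔ M) M (ℕ.m≤n⊔m I M) ℕ.≤-refl ⟩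
    + 1 / suc n            ≡⟨ ℚ.*-identityˡ (+ 1 / suc n) ⟨
    1ℚ ℚ.* (+ 1 / suc n)   ≤⟨ 1/n≤ε n (ℕ.m⊔n≤o⇒n≤o n₀ N ≤n) ⟩
    ε                      ∎) ⟩
  ε ℚ.+ (y ℚ.- ε)          ≡⟨ solve 2 (λ y ε → ε :+ (y :- ε) := y) refl y ε ⟩
  y                        ∎
  where
  open ℚ.≤-Reasoning
  N = proj₁ (archimedean 1ℚ ε)
  1/n≤ε = proj₂ (archimedean 1ℚ ε)

-- `recip` inverts the maximum of `approx x n` and δ, which is still at most 1 because eventually δ
-- ≤ x ≤ 1. Used for 1/(1 - ε) ≥ 1.
recip-≲ : ∀ {x} (x>0 : 0ℝ <ᴿ x) → (∃ λ N → ∀ n → N ≤ n → approx x n ℚ.≤ 1ℚ) → 1ℚ ≲ recip x x>0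
recip-≲ {x} (δ , δ>0 , N , x≥δ) (M , x≤1) = N ⊔ M , λ n ≤n →
  let x≤1 = x≤1 n (ℕ.m⊔n≤o⇒n≤o N M ≤n)
      a = approx x n ℚ.⊔ δ
      a≤1 : a ℚ.≤ 1ℚ
      a≤1 = ℚ.⊔-lub x≤1 (ℚ.≤-trans (subst (ℚ._≤ approx x n) (ℚ.+-identityˡ δ) (x≥δ n (ℕ.m⊔n≤o⇒m≤o N M ≤n))) x≤1)
      a>0 = positive (ℚ.<-≤-trans (ℚ.positive⁻¹ δ {{δ>0}}) (ℚ.p≤q⊔p (approx x n) δ))
      a≢0 = ℚ.pos⇒nonZero a {{a>0}}
      b = (ℚ.1/ a) {{a≢0}}
  in begin
  1ℚ        ≡⟨ ℚ.*-inverseʳ a {{a≢0}} ⟨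
  a ℚ.* b   ≤⟨ ℚ.*-monoʳ-≤-nonNeg b {{ℚ.pos⇒nonNeg b {{ℚ.1/pos⇒pos a {{a>0}}}}}} a≤1 ⟩
  1ℚ ℚ.* b  ≡⟨ ℚ.*-identityˡ b ⟩
  b         ∎
  where open ℚ.≤-Reasoning

-- Lower bounds for exp from its partial sums

module _ {l : ℚ} (0≤l : 0ℚ ℚ.≤ l) where
  private
    -- For the constant sequence `fromℚ l` every approximation is the exact value, so index 0 stands
    -- for all.
    term sum : ℕ → ℚ
    term n = approx (expTerm (fromℚ l) n) 0
    sum  n = approx (expSum (fromℚ l) n) 0

    0≤1/ : ∀ n → 0ℚ ℚ.≤ + 1 / suc n
    0≤1/ n = ℚ.<⇒≤ (ℚ.positive⁻¹ (+ 1 / suc n) {{/-pos {n}}})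

    0≤term : ∀ n → 0ℚ ℚ.≤ term n
    0≤term zero    = from-yes (0ℚ ℚ.≤? 1ℚ)
    0≤term (suc n) = 0≤* (0≤* (0≤term n) 0≤l) (0≤1/ n)

    term-≤ : ∀ {x i} → l ℚ.≤ approx x i → ∀ n → term n ℚ.≤ approx (expTerm x n) i
    term-≤ l≤x zero    = ℚ.≤-refl
    term-≤ {x} {i} l≤x (suc n) =
      *-mono (0≤* (ℚ.≤-trans (0≤term n) (term-≤ {x} {i} l≤x n)) (ℚ.≤-trans 0≤l l≤x)) (0≤1/ n)
        (*-mono (ℚ.≤-trans (0≤term n) (term-≤ {x} {i} l≤x n)) 0≤l (term-≤ {x} {i} l≤x n) l≤x)
        ℚ.≤-refl

    sum-≤ : ∀ {x i} → l ℚ.≤ approx x i → ∀ n → sum n ℚ.≤ approx (expSum x n) i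
    sum-≤ l≤x zero    = ℚ.≤-refl
    sum-≤ {x} {i} l≤x (suc n) = ℚ.+-mono-≤ (sum-≤ {x} {i} l≤x n) (term-≤ {x} {i} l≤x n)

    sum-mono : ∀ m j → sum m ℚ.≤ sum (j + m)
    sum-mono m zero    = ℚ.≤-refl
    sum-mono m (suc j) = ℚ.≤-trans (sum-mono m j)
      (subst (ℚ._≤ sum (suc j + m)) (ℚ.+-identityʳ (sum (j + m))) (ℚ.+-monoʳ-≤ (sum (j + m)) (0≤term (j + m))))

  -- For arguments at least `l ≥ 0` the terms are nonnegative and increase with the argument, so the
  -- m-th partial sum at `l` bounds all later partial sums at `x` from below.
  exp-≲ : ∀ {x} → l ≲ x → ∀ m ε .{{_ : Positive ε}} → approx (expSum (fromℚ l) m) 0 ℚ.- ε ≲ exp x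
  exp-≲ {x} (N , l≤x) m ε = lim-≲ {expSum x} (expSum-cauchy x) m (λ n m≤n → N , λ i N≤i →
    ℚ.≤-trans (subst (λ n → sum m ℚ.≤ sum n) (ℕ.m∸n+n≡m m≤n) (sum-mono m (n ∸ m))) (sum-≤ {x} {i} (l≤x i N≤i) n)) ε

-- Riemann-sum bounds for log, γ and e^γ

H-mono : ∀ m j → H m ℚ.≤ H (j + m)
H-mono m zero    = ℚ.≤-refl
H-mono m (suc j) = ℚ.≤-trans (H-mono m j)
  (subst (ℚ._≤ H (suc j + m)) (ℚ.+-identityʳ (H (j + m)))
    (ℚ.+-monoʳ-≤ (H (j + m)) (ℚ.<⇒≤ (ℚ.positive⁻¹ (+ 1 / suc (j + m)) {{/-pos {j + m}}}))))

-- Raising m by one adds a block of k reciprocals and removes 1/(m+1), which the block outweighs by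
-- `Block.lower`. Hence every Riemann sum is a lower bound for the logarithm.
logApprox-mono : ∀ k′ m′ j → logApprox (suc k′) (suc m′) ℚ.≤ logApprox (suc k′) (j + suc m′)
logApprox-mono k′ m′ zero    = ℚ.≤-refl
logApprox-mono k′ m′ (suc j) = ℚ.≤-trans (logApprox-mono k′ m′ j)
  (subst (λ n → logApprox k n ℚ.≤ logApprox k (suc n)) (sym (ℕ.+-suc j m′)) (begin
    H (k * n) ℚ.- H n                                     ≡⟨ solve 3 (λ p q r → p :- q := (p :+ r) :- (q :+ r)) refl (H (k * n)) (H n) (+ 1 / suc n) ⟩
    (H (k * n) ℚ.+ + 1 / suc n) ℚ.- H (suc n)             ≤⟨ ℚ.+-monoˡ-≤ (ℚ.- H (suc n)) (ℚ.+-monoʳ-≤ (H (k * n)) (Block.lower k′ (j + m′))) ⟩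
    (H (k * n) ℚ.+ (H (k * suc n) ℚ.- H (k * n))) ℚ.- H (suc n)
      ≡⟨ solve 3 (λ p q r → (p :+ (q :- p)) :- r := q :- r) refl (H (k * n)) (H (k * suc n)) (H (suc n)) ⟩
    H (k * suc n) ℚ.- H (suc n)                           ∎))
  where
  open ℚ.≤-Reasoning
  k = suc k′
  n = suc (j + m′)

log-≲ : ∀ k .{{_ : NonZero k}} m .{{_ : NonZero m}} → logApprox k m ≲ log k
log-≲ k@(suc k′) m@(suc m′) = m , λ n m≤n →
  subst (λ n → logApprox k m ℚ.≤ logApprox k n) (ℕ.m∸n+n≡m m≤n) (logApprox-mono k′ m′ (n ∸ m))

-- With e^γ ≥ 8/5 this gives 4 e^γ log 2 ≥ 48/11, just above 13/3.
15/22≲log2 : + 15 / 22 ≲ log 2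
15/22≲log2 = ≲-≤ {x = log 2} (from-yes (+ 15 / 22 ℚ.≤? logApprox 2 25)) (log-≲ 2 25)

-- 5/6 = 1/2 + 1/3 is the Riemann sum of mesh 1 for log 3; a larger k only adds terms.
5/6≲log : ∀ k .{{_ : NonZero k}} → 3 ≤ k → + 5 / 6 ≲ log k
5/6≲log k 3≤k = ≲-≤ {x = log k} (begin
  + 5 / 6              ≤⟨ from-yes (+ 5 / 6 ℚ.≤? H 3 ℚ.- H 1) ⟩
  H 3 ℚ.- H 1          ≤⟨ ℚ.+-monoˡ-≤ (ℚ.- H 1) (H-mono 3 (k ∸ 3)) ⟩
  H (k ∸ 3 + 3) ℚ.- H 1 ≡⟨ cong (λ n → H n ℚ.- H 1) (trans (ℕ.m∸n+n≡m 3≤k) (sym (ℕ.*-identityʳ k))) ⟩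
  logApprox k 1        ∎) (log-≲ k 1)
  where open ℚ.≤-Reasoning

-- 1/x lies below its chord on [n, n + 1], so the Riemann sum
-- 1/(in + 1) + ⋯ + 1/(in + i) is at most the trapezoid (1/n + 1/(n + 1))/2.
module Trapezoid (i′ n′ : ℕ) where
  i = suc i′
  n = suc n′
  private
    open ℚ.≤-Reasoning
    D = i * i * (n * suc n)
    D′ = pred D

    tail : ℕ → ℚ
    tail p = H (i * n + i) ℚ.- H (i * n + p)

    -- The right side is the height of the chord at n + (p+1)/i, divided by i. After
    -- cross-multiplication the slack is `L * suc p`.
    term≤ : ∀ p L → p + suc L ≡ i → + 1 / suc (i * n + p) ℚ.≤ + (i * n + L) / suc D′
    term≤ p L eq = /-mono 1 (i * n + L) (i * n + p) D′ (subst₂ _≤_ (sym (ℕ.*-identityˡ D)) refl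
      (subst (λ i → i * i * (n * suc n) ≤ (i * n + L) * suc (i * n + p)) eq
        (subst ((p + suc L) * (p + suc L) * (n * suc n) ≤_) (chord p L n) (ℕ.m≤m+n _ (L * suc p)))))
      where
      chord : ∀ p L n → (p + suc L) * (p + suc L) * (n * suc n) + L * suc p ≡
                        ((p + suc L) * n + L) * suc ((p + suc L) * n + p)
      chord = ℕ.solve-∀

    -- Twice the sum of the last L chord values has numerator 2L(in) + L(L - 1). The rounding up to
    -- L² makes the numerator at L = i split as i²(n+1) + i²n, which gives 1/n + 1/(n+1).
    tails≤ : ∀ p L → p + L ≡ i → tail p ℚ.+ tail p ℚ.≤ + (2 * L * (i * n) + L * L) / suc D′
    tails≤ p zero eq = begin
      tail p ℚ.+ tail p    ≡⟨ cong (λ q → tail q ℚ.+ tail q) (trans (sym (ℕ.+-identityʳ p)) eq) ⟩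
      tail i ℚ.+ tail i    ≡⟨ solve 1 (λ h → (h :- h) :+ (h :- h) := con 0ℚ) refl (H (i * n + i)) ⟩
      0ℚ                   ≡⟨ ℚ.0/n≡0 (suc D′) ⟨
      + 0 / suc D′         ∎
    tails≤ p (suc L) eq = begin
      tail p ℚ.+ tail p                                  ≡⟨ solve 3 (λ h a r → (h :- a) :+ (h :- a) :=
                                                              ((h :- (a :+ r)) :+ (h :- (a :+ r))) :+ (r :+ r)) refl
                                                              (H (i * n + i)) (H (i * n + p)) r ⟩
      (T ℚ.+ T) ℚ.+ (r ℚ.+ r)                            ≤⟨ ℚ.+-mono-≤ IH (ℚ.+-mono-≤ (term≤ p L eq) (term≤ p L eq)) ⟩
      + a / suc D′ ℚ.+ (+ b / suc D′ ℚ.+ + b / suc D′)   ≡⟨ cong (+ a / suc D′ ℚ.+_) (/-+ b b D′) ⟩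
      + a / suc D′ ℚ.+ + (b + b) / suc D′                ≡⟨ /-+ a (b + b) D′ ⟩
      + (a + (b + b)) / suc D′                           ≤⟨ /-mono (a + (b + b)) a′ D′ D′ (ℕ.*-monoˡ-≤ (suc D′) le) ⟩
      + a′ / suc D′                                      ∎
      where
      a′ = 2 * suc L * (i * n) + suc L * suc L
      r = + 1 / suc (i * n + p)
      T = H (i * n + i) ℚ.- (H (i * n + p) ℚ.+ r)
      a = 2 * L * (i * n) + L * L
      b = i * n + L
      IH : T ℚ.+ T ℚ.≤ + a / suc D′
      IH = subst (λ m → (H (i * n + i) ℚ.- H m) ℚ.+ (H (i * n + i) ℚ.- H m) ℚ.≤ + a / suc D′)
        (ℕ.+-suc (i * n) p) (tails≤ (suc p) L (trans (sym (ℕ.+-suc p L)) eq))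
      arith : ∀ L x → (2 * L * x + L * L) + ((x + L) + (x + L)) + 1 ≡ 2 * suc L * x + suc L * suc L
      arith = ℕ.solve-∀
      le : a + (b + b) ≤ 2 * suc L * (i * n) + suc L * suc L
      le = subst (a + (b + b) ≤_) (arith L (i * n)) (ℕ.m≤m+n _ 1)

  block : ℚ
  block = H (suc n * i) ℚ.- H (n * i)

  trapezoid : block ℚ.+ block ℚ.≤ + 1 / n ℚ.+ + 1 / suc n
  trapezoid = begin
    block ℚ.+ block                          ≡⟨ cong (λ t → t ℚ.+ t) (cong₂ (λ p q → H p ℚ.- H q) top bottom) ⟩
    tail 0 ℚ.+ tail 0                        ≤⟨ tails≤ 0 i refl ⟩
    + (2 * i * (i * n) + i * i) / suc D′     ≡⟨ cong (λ c → + c / suc D′) (split i n) ⟩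
    + (a + b) / suc D′                       ≡⟨ /-+ a b D′ ⟨
    + a / suc D′ ℚ.+ + b / suc D′            ≤⟨ ℚ.+-mono-≤ (/-mono a 1 D′ n′ (ℕ.≤-reflexive (cancelₐ i n)))
                                                           (/-mono b 1 D′ n (ℕ.≤-reflexive (cancel_b i n))) ⟩
    + 1 / n ℚ.+ + 1 / suc n                  ∎
    where
    a = i * i * suc n
    b = i * i * n
    top : suc n * i ≡ i * n + i
    top = trans (ℕ.+-comm i (n * i)) (cong (_+ i) (ℕ.*-comm n i))
    bottom : n * i ≡ i * n + 0
    bottom = trans (ℕ.*-comm n i) (sym (ℕ.+-identityʳ (i * n)))
    split : ∀ i n → 2 * i * (i * n) + i * i ≡ i * i * suc n + i * i * n
    split = ℕ.solve-∀
    cancelₐ : ∀ i n → i * i * suc n * n ≡ 1 * (i * i * (n * suc n))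
    cancelₐ = ℕ.solve-∀
    cancel_b : ∀ i n → i * i * n * suc n ≡ 1 * (i * i * (n * suc n))
    cancel_b = ℕ.solve-∀

½≤H-log : ∀ n i .{{_ : NonZero i}} → ½ ℚ.≤ H (suc n) ℚ.- logApprox (suc n) i
½≤H-log n i@(suc i′) = begin
  ½ ℚ.* 1ℚ                       ≤⟨ ℚ.*-monoˡ-≤-nonNeg ½ (begin
    1ℚ                             ≡⟨ ℚ.+-identityʳ 1ℚ ⟨
    1ℚ ℚ.+ 0ℚ                      ≤⟨ ℚ.+-monoʳ-≤ 1ℚ (ℚ.<⇒≤ (ℚ.positive⁻¹ (+ 1 / suc n) {{/-pos {n}}})) ⟩
    1ℚ ℚ.+ + 1 / suc n             ≤⟨ twice n ⟩
    f n ℚ.+ f n                    ∎) ⟩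
  ½ ℚ.* (f n ℚ.+ f n)            ≡⟨ solve 1 (λ x → con ½ :* (x :+ x) := x) refl (f n) ⟩
  f n                            ∎
  where
  open ℚ.≤-Reasoning
  f : ℕ → ℚ
  f n = H (suc n) ℚ.- logApprox (suc n) i

  -- The surplus 1/(n+1) makes the induction telescope: passing to n+1 adds 2/(n+2) and, by the
  -- trapezoid bound, costs at most 1/(n+1) + 1/(n+2).
  twice : ∀ n → 1ℚ ℚ.+ + 1 / suc n ℚ.≤ f n ℚ.+ f n
  twice zero = ℚ.≤-reflexive (sym (begin-equality
    f 0 ℚ.+ f 0                                ≡⟨ cong (λ m → (1ℚ ℚ.- (H m ℚ.- H i)) ℚ.+ (1ℚ ℚ.- (H m ℚ.- H i))) (ℕ.*-identityˡ i) ⟩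
    (1ℚ ℚ.- (H i ℚ.- H i)) ℚ.+ (1ℚ ℚ.- (H i ℚ.- H i)) ≡⟨ solve 1 (λ h → (con 1ℚ :- (h :- h)) :+ (con 1ℚ :- (h :- h)) := con 1ℚ :+ con 1ℚ) refl (H i) ⟩
    1ℚ ℚ.+ 1ℚ                                  ∎))
  twice (suc n) = begin
    1ℚ ℚ.+ r′                                        ≡⟨ solve 2 (λ r r′ → con 1ℚ :+ r′ := (con 1ℚ :+ r) :+ ((r′ :+ r′) :- (r :+ r′))) refl r r′ ⟩
    (1ℚ ℚ.+ r) ℚ.+ ((r′ ℚ.+ r′) ℚ.- (r ℚ.+ r′))      ≤⟨ ℚ.+-mono-≤ (twice n) (ℚ.+-monoʳ-≤ (r′ ℚ.+ r′) (ℚ.neg-antimono-≤ trapezoid)) ⟩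
    (f n ℚ.+ f n) ℚ.+ ((r′ ℚ.+ r′) ℚ.- (block ℚ.+ block))
      ≡⟨ solve 5 (λ h p s r′ q → ((h :- (p :- s)) :+ (h :- (p :- s))) :+ ((r′ :+ r′) :- ((q :- p) :+ (q :- p)))
                   := ((h :+ r′) :- (q :- s)) :+ ((h :+ r′) :- (q :- s))) refl
           (H (suc n)) (H (suc n * i)) (H i) r′ (H (suc (suc n) * i)) ⟩
    f (suc n) ℚ.+ f (suc n)                          ∎
    where
    open Trapezoid i′ n using (block; trapezoid)
    r  = + 1 / suc n
    r′ = + 1 / suc (suc n)

-- 1/2 less the loss 1/100 taken for `lim-≲`.
49/100≲γ : + 49 / 100 ≲ γ
49/100≲γ = lim-≲ {λ n → fromℚ (H (suc n)) -ᴿ log (suc n)} {½} H-log-cauchy 0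
  (λ n _ → 1 , λ i 1≤i → ½≤H-log n i {{ℕ.>-nonZero 1≤i}}) (+ 1 / 100)

-- Three terms at 0.49 give 1 + 0.49 + 0.12005 = 1.61005, barely enough after the loss 1/100.
8/5≲exp-γ : + 8 / 5 ≲ exp γ
8/5≲exp-γ = ≲-≤ {x = exp γ} (from-yes (+ 8 / 5 ℚ.≤? approx (expSum (fromℚ (+ 49 / 100)) 3) 0 ℚ.- + 1 / 100))
  (exp-≲ (from-yes (0ℚ ℚ.≤? + 49 / 100)) {γ} 49/100≲γ 3 (+ 1 / 100))

-- Comparison of the modulus with the asymptotic bound

module RealBound (k : ℕ) .{{_ : NonZero k}} (ε : ℝ) (0<ε : 0ℝ <ᴿ ε) (ε<1 : ε <ᴿ 1ℝ)
                 {l : ℚ} (0≤l : 0ℚ ℚ.≤ l) (l≲log : l ≲ log k) where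

  bound : ℕ → ℝ
  bound d = 1ℝ +ᴿ fromℕ 2 *ᴿ exp γ *ᴿ recip (1ℝ -ᴿ ε) (x<y⇒0<y-x {ε} {1ℝ} ε<1) *ᴿ fromℕ d *ᴿ fromℕ k *ᴿ log k

  private
    coefficient : ℕ → ℚ
    coefficient d = + 2 / 1 ℚ.* (+ 8 / 5) ℚ.* 1ℚ ℚ.* (+ d / 1) ℚ.* (+ k / 1)

    0≤/1 : ∀ n → 0ℚ ℚ.≤ + n / 1
    0≤/1 n = ℚ.nonNegative⁻¹ (+ n / 1) {{/-nonNeg {n} {0}}}

    1-ε≤1 : ∃ λ N → ∀ n → N ≤ n → approx (1ℝ -ᴿ ε) n ℚ.≤ 1ℚ
    1-ε≤1 = let δ , δ>0 , N , δ≤ε = 0<ε in N , λ n N≤n →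
      ℚ.+-monoʳ-≤ 1ℚ (ℚ.neg-antimono-≤ (ℚ.≤-trans (ℚ.+-monoʳ-≤ 0ℚ (ℚ.<⇒≤ (ℚ.positive⁻¹ δ {{δ>0}}))) (δ≤ε n N≤n)))

    bound-≲ : ∀ d → 1ℚ ℚ.+ coefficient d ℚ.* l ≲ bound d
    bound-≲ d =
      +-≲ {x = 1ℝ} {y = x₅ *ᴿ log k} (fromℚ-≲ 1ℚ)
        (*-≲ {x = x₅} {y = log k} 0≤₅ 0≤l
          (*-≲ {x = x₄} {y = fromℕ k} 0≤₄ (0≤/1 k)
            (*-≲ {x = x₃} {y = fromℕ d} 0≤₃ (0≤/1 d)
              (*-≲ {x = x₂} {y = ρ} 0≤₂ 0≤1
                (*-≲ {x = fromℕ 2} {y = exp γ} (0≤/1 2) 0≤8/5 (fromℚ-≲ (+ 2 / 1)) 8/5≲exp-γ)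
                (recip-≲ {1ℝ -ᴿ ε} (x<y⇒0<y-x {ε} {1ℝ} ε<1) 1-ε≤1))
              (fromℚ-≲ (+ d / 1)))
            (fromℚ-≲ (+ k / 1)))
          l≲log)
      where
      ρ  = recip (1ℝ -ᴿ ε) (x<y⇒0<y-x {ε} {1ℝ} ε<1)
      x₂ = fromℕ 2 *ᴿ exp γ
      x₃ = x₂ *ᴿ ρ
      x₄ = x₃ *ᴿ fromℕ d
      x₅ = x₄ *ᴿ fromℕ k
      0≤1 = from-yes (0ℚ ℚ.≤? 1ℚ)
      0≤8/5 = from-yes (0ℚ ℚ.≤? (+ 8 / 5))
      0≤₂ = 0≤* (0≤/1 2) 0≤8/5
      0≤₃ = 0≤* 0≤₂ 0≤1
      0≤₄ = 0≤* 0≤₃ (0≤/1 d)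
      0≤₅ = 0≤* 0≤₄ (0≤/1 k)

  -- Turns the real inequality into one between naturals: 16/5 = 2 · 8/5 uses the estimate of e^γ,
  -- and `eq` writes 16/5 · `l` as the fraction a/(b+1).
  ≤bound : ∀ a b → (+ 16 / 5) ℚ.* l ≡ (+ a / 1) ℚ.* (+ 1 / suc b) →
           ∀ d χ → χ * suc b ≤ a * (d * k) → fromℕ χ ≤ᴿ bound d
  ≤bound a b eq d χ χ≤ = ≲⇒fromℚ-≤ᴿ {x = bound d} (≲-≤ {x = bound d} (begin
    + χ / 1                                           ≤⟨ /-mono χ (a * (d * k)) 0 b
                                                             (ℕ.≤-trans χ≤ (ℕ.≤-reflexive (sym (ℕ.*-identityʳ _)))) ⟩
    + (a * (d * k)) / suc b                           ≡⟨ /-* (a * (d * k)) b ⟨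
    (+ (a * (d * k)) / 1) ℚ.* β                       ≡⟨ cong (ℚ._* β) (trans (/1-* a (d * k)) (cong (α ℚ.*_) (/1-* d k))) ⟩
    (α ℚ.* (δ ℚ.* κ)) ℚ.* β                             ≡⟨ solve 4 (λ α β δ κ → (α :* (δ :* κ)) :* β := (α :* β) :* (δ :* κ)) refl α β δ κ ⟩
    (α ℚ.* β) ℚ.* (δ ℚ.* κ)                             ≡⟨ cong (ℚ._* (δ ℚ.* κ)) eq ⟨
    ((+ 16 / 5) ℚ.* l) ℚ.* (δ ℚ.* κ)                  ≡⟨ solve 3 (λ l δ κ → (con (+ 16 / 5) :* l) :* (δ :* κ) :=
                                                             con (+ 2 / 1) :* con (+ 8 / 5) :* con 1ℚ :* δ :* κ :* l) refl l δ κ ⟩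
    coefficient d ℚ.* l                                 ≡⟨ ℚ.+-identityˡ (coefficient d ℚ.* l) ⟨
    0ℚ ℚ.+ coefficient d ℚ.* l                          ≤⟨ ℚ.+-monoˡ-≤ (coefficient d ℚ.* l) (from-yes (0ℚ ℚ.≤? 1ℚ)) ⟩
    1ℚ ℚ.+ coefficient d ℚ.* l                          ∎) (bound-≲ d))
    where
    open ℚ.≤-Reasoning
    α = + a / 1
    β = + 1 / suc b
    δ = + d / 1
    κ = + k / 1

-- Over the common denominator 33, 13/3 < 48/11 reads 143 < 144. The spare `d` absorbs the constant
-- 11 · 13 · 9 = 1287.
colours-k=2 : ∀ {χ N d} → χ ≤ N → N * 3 ≤ 13 * (d + 3 * suc (2 !)) → 1287 < d → χ * 11 ≤ 24 * (d * 2)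
colours-k=2 {χ} {N} {d} χ≤N N≤ d> = ℕ.*-cancelʳ-≤ (χ * 11) (24 * (d * 2)) 3 (begin
  χ * 11 * 3                   ≤⟨ ℕ.*-monoˡ-≤ 3 (ℕ.*-monoˡ-≤ 11 χ≤N) ⟩
  N * 11 * 3                   ≡⟨ swap N ⟩
  11 * (N * 3)                 ≤⟨ ℕ.*-monoʳ-≤ 11 N≤ ⟩
  11 * (13 * (d + 9))          ≡⟨ expand d ⟩
  143 * d + 1287               ≤⟨ ℕ.+-monoʳ-≤ (143 * d) (ℕ.<⇒≤ d>) ⟩
  143 * d + d                  ≡⟨ collect d ⟩
  24 * (d * 2) * 3             ∎)
  where
  open ℕ.≤-Reasoning
  swap : ∀ N → N * 11 * 3 ≡ 11 * (N * 3)
  swap = ℕ.solve-∀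
  expand : ∀ d → 11 * (13 * (d + 9)) ≡ 143 * d + 1287
  expand = ℕ.solve-∀
  collect : ∀ d → 143 * d + d ≡ 24 * (d * 2) * 3
  collect = ℕ.solve-∀

-- Of the 8dk available, 6dk + 3d pays for 3(2k+1)d. As k ≥ 3, the other 2dk is at least 6d, leaving
-- more than the `d` that absorbs the constant.
colours-k≥3 : ∀ {k χ N d} C → 3 ≤ k → χ ≤ N → N * 1 ≤ (2 * k + 1) * (d + 1 * C) → 3 * (2 * k + 1) * C < d →
              χ * 3 ≤ 8 * (d * k)
colours-k≥3 {k} {χ} {N} {d} C 3≤k χ≤N N≤ d> = begin
  χ * 3                                            ≤⟨ ℕ.*-monoˡ-≤ 3 (ℕ.≤-trans χ≤N (subst (_≤ (2 * k + 1) * (d + 1 * C)) (ℕ.*-identityʳ N) N≤)) ⟩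
  (2 * k + 1) * (d + 1 * C) * 3                    ≡⟨ expand k d C ⟩
  6 * (d * k) + 3 * d + 3 * (2 * k + 1) * C        ≤⟨ ℕ.+-monoʳ-≤ (6 * (d * k) + 3 * d) (ℕ.<⇒≤ d>) ⟩
  6 * (d * k) + 3 * d + d                          ≤⟨ ℕ.m≤m+n (6 * (d * k) + 3 * d + d) (2 * d) ⟩
  6 * (d * k) + 3 * d + d + 2 * d                  ≡⟨ collect k d ⟩
  6 * (d * k) + 2 * (d * 3)                        ≤⟨ ℕ.+-monoʳ-≤ (6 * (d * k)) (ℕ.*-monoʳ-≤ 2 (ℕ.*-monoʳ-≤ d 3≤k)) ⟩
  6 * (d * k) + 2 * (d * k)                        ≡⟨ ℕ.*-distribʳ-+ (d * k) 6 2 ⟨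
  8 * (d * k)                                      ∎
  where
  open ℕ.≤-Reasoning
  expand : ∀ k d C → (2 * k + 1) * (d + 1 * C) * 3 ≡ 6 * (d * k) + 3 * d + 3 * (2 * k + 1) * C
  expand = ℕ.solve-∀
  collect : ∀ k d → 6 * (d * k) + 3 * d + d + 2 * d ≡ 6 * (d * k) + 2 * (d * 3)
  collect = ℕ.solve-∀

-- Both bounds for the product, from their separating families

theorem1 : ∀ {ℓ} →
    (∀ (𝓕 : Pred Graph ℓ) → IsForbiddenFamily 𝓕 →
     ∀ (k d : ℕ) → 1 ≤ k → 1 ≤ d →
     ∀ (Gs : Vec Graph d) (χs : Fin d → ℕ) →
     (∀ i → IsFreeChromaticNumber 𝓕 (lookup Gs i) (χs i)) →
     (∀ i → χs i ≤ k + 1) →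
     ∀ χ → IsFreeChromaticNumber 𝓕 (□ Gs) χ →
     χ ≤ 2 * k * (k * d ∸ k + 1) + 1)
    ×
    -- For k = 1 the right-hand side would be 1, since log 1 = 0.
    (∀ (k : ℕ) .{{_ : NonZero k}} → 2 ≤ k →
     ∀ (ε : ℝ) → 0ℝ <ᴿ ε → (ε<1 : ε <ᴿ 1ℝ) →
     ∃ λ D → ∀ (d : ℕ) → D < d →
     ∀ (𝓕 : Pred Graph ℓ) → IsForbiddenFamily 𝓕 →
     ∀ (Gs : Vec Graph d) (χs : Fin d → ℕ) →
     (∀ i → IsFreeChromaticNumber 𝓕 (lookup Gs i) (χs i)) →
     (∀ i → χs i ≤ k + 1) →
     ∀ χ → IsFreeChromaticNumber 𝓕 (□ Gs) χ →
     fromℕ χ ≤ᴿ 1ℝ +ᴿ fromℕ 2 *ᴿ exp γ *ᴿ recip (1ℝ -ᴿ ε) (x<y⇒0<y-x {ε} {1ℝ} ε<1) *ᴿ fromℕ d *ᴿ fromℕ k *ᴿ log k)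
theorem1 {ℓ} = all-dimensions , large-dimensions
  where
  all-dimensions : ∀ (𝓕 : Pred Graph ℓ) → IsForbiddenFamily 𝓕 →
    ∀ (k d : ℕ) → 1 ≤ k → 1 ≤ d →
    ∀ (Gs : Vec Graph d) (χs : Fin d → ℕ) →
    (∀ i → IsFreeChromaticNumber 𝓕 (lookup Gs i) (χs i)) →
    (∀ i → χs i ≤ k + 1) →
    ∀ χ → IsFreeChromaticNumber 𝓕 (□ Gs) χ →
    χ ≤ 2 * k * (k * d ∸ k + 1) + 1
  all-dimensions 𝓕 forb k d 1≤k 1≤d Gs χs isχs χs≤ χ isχ =
    χ-□≤ forb {{ℕ.>-nonZero (ℕ.m≤n+m 1 _)}} (progression-separating 1≤k 1≤d) Gs χs isχs χs≤ isχ

  large-dimensions : ∀ (k : ℕ) .{{_ : NonZero k}} → 2 ≤ k →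
    ∀ (ε : ℝ) → 0ℝ <ᴿ ε → (ε<1 : ε <ᴿ 1ℝ) →
    ∃ λ D → ∀ (d : ℕ) → D < d →
    ∀ (𝓕 : Pred Graph ℓ) → IsForbiddenFamily 𝓕 →
    ∀ (Gs : Vec Graph d) (χs : Fin d → ℕ) →
    (∀ i → IsFreeChromaticNumber 𝓕 (lookup Gs i) (χs i)) →
    (∀ i → χs i ≤ k + 1) →
    ∀ χ → IsFreeChromaticNumber 𝓕 (□ Gs) χ →
    fromℕ χ ≤ᴿ 1ℝ +ᴿ fromℕ 2 *ᴿ exp γ *ᴿ recip (1ℝ -ᴿ ε) (x<y⇒0<y-x {ε} {1ℝ} ε<1) *ᴿ fromℕ d *ᴿ fromℕ k *ᴿ log k
  large-dimensions 1 (s≤s ())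
  large-dimensions 2 _ ε 0<ε ε<1 = 1287 , λ d d> 𝓕 forb Gs χs isχs χs≤ χ isχ →
    let N , N≢0 , N≤ , s , sep = dense-separating {2} {13} {3} Splitting-13.base-separating d
        χ≤N = χ-□≤ forb {{N≢0}} sep Gs χs isχs χs≤ isχ
    in RealBound.≤bound 2 ε 0<ε ε<1 (from-yes (0ℚ ℚ.≤? (+ 15 / 22))) 15/22≲log2
         -- 16/5 · 15/22 = 24/11, with the denominator passed as its predecessor.
         24 10 refl d χ (colours-k=2 χ≤N N≤ d>)
  large-dimensions k@(suc (suc (suc _))) _ ε 0<ε ε<1 = 3 * (2 * k + 1) * suc (k !) ,
    λ d d> 𝓕 forb Gs χs isχs χs≤ χ isχ →
    let N , N≢0 , N≤ , s , sep = dense-separating {k} {2 * k + 1} {1} (singleton-separating k) d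
        χ≤N = χ-□≤ forb {{N≢0}} sep Gs χs isχs χs≤ isχ
    in RealBound.≤bound k ε 0<ε ε<1 (from-yes (0ℚ ℚ.≤? (+ 5 / 6))) (5/6≲log k 3≤k)
         -- 16/5 · 5/6 = 8/3, again with the predecessor of the denominator.
         8 2 refl d χ (colours-k≥3 (suc (k !)) 3≤k χ≤N N≤ d>)
    where
    3≤k : 3 ≤ k
    3≤k = s≤s (s≤s (s≤s z≤n))
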